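{- Let $n \ge 2$ be an integer and let $G = P_n \Box P_2$. Then $$S_{SC}(G) = \left(\{1\} \cup \left\{ 2j : j \in \mathbb{Z},\ \left\lfloor \tfrac{n}{2} \right\rfloor \le j \le n-1 \right\}\right) \setminus \{2\}.$$
   Context: $P_n$ denotes the path on $n$ vertices and $G\Box H$ the cartesian product of graphs. An orientation $D$ of a graph is strong if for every ordered pair of vertices $u,v$ there is a directed path from $u$ to $v$. A $uv$-geodesic in $D$ is a shortest directed path from $u$ to $v$. A nonempty set $S\subseteq V(D)$ is convex in $D$ if for every $u,v\in S$, every vertex lying on a $uv$-geodesic or on a $vu$-geodesic belongs to $S$. The convexity number $\mathrm{con}(D)$ is the maximum cardinality of a convex set of $D$ different from $V(D)$. The strong convexity spectrum of a graph $G$ is $S_{SC}(G)=\{\mathrm{con}(D) : D \text{ is a strong orientation of } G\}$. -}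

module Defs where

open import Data.Fin.Base using (Fin; toℕ; remQuot)
open import Data.Fin.Subset using (Subset; _∈_; ∣_∣; Nonempty; ⊤)
open import Data.List.Base using (List; []; _∷_)
open import Data.List.Membership.Propositional using () renaming (_∈_ to _∈ˡ_)
open import Data.List.Relation.Unary.Unique.Propositional using (Unique)
open import Data.Nat.Base using (ℕ; suc; _*_; _≤_)
open import Data.Nat.Properties using (1+n≢n)
open import Data.Product.Base using (Σ-syntax; ∃-syntax; _×_; _,_; proj₁)
open import Data.Sum.Base using (_⊎_; inj₁; inj₂; swap)
open import Function.Base using (_on_)
open import Level using (0ℓ)
open import Relation.Binary.Core using (Rel)
open import Relation.Binary.Construct.Closure.ReflexiveTransitive using (Star; ε; _◅_)
open import Relation.Binary.Definitions using (Symmetric; Irreflexive; Asymmetric)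
open import Relation.Binary.PropositionalEquality using (_≡_; _≢_; refl; sym)
open import Relation.Unary using (Pred)

record Graph (n : ℕ) : Set₁ where
  field
    Adj        : Rel (Fin n) 0ℓ
    adj-sym    : Symmetric Adj
    adj-irrefl : Irreflexive _≡_ Adj

open Graph public

P : (n : ℕ) → Graph n
P n .Adj i j = suc (toℕ i) ≡ toℕ j ⊎ suc (toℕ j) ≡ toℕ i
P n .adj-sym = swap
P n .adj-irrefl refl (inj₁ eq) = 1+n≢n eq
P n .adj-irrefl refl (inj₂ eq) = 1+n≢n eq

□-Adj : ∀ {m n} → Graph m → Graph n → Rel (Fin m × Fin n) 0ℓ
□-Adj G H (a , b) (c , d) = (a ≡ c × Adj H b d) ⊎ (Adj G a c × b ≡ d)

infixr 6 _□_

-- Vertices are the pairs in Fin m × Fin n, numbered by Data.Fin.combine;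
-- remQuot n is the inverse of this numbering.
_□_ : ∀ {m n} → Graph m → Graph n → Graph (m * n)
_□_ {m} {n} G H .Adj = □-Adj G H on remQuot {m} n
(G □ H) .adj-sym (inj₁ (a≡c , bd)) = inj₁ (sym a≡c , adj-sym H bd)
(G □ H) .adj-sym (inj₂ (ac , b≡d)) = inj₂ (adj-sym G ac , sym b≡d)
(G □ H) .adj-irrefl refl (inj₁ (_ , bb)) = adj-irrefl H refl bb
(G □ H) .adj-irrefl refl (inj₂ (aa , _)) = adj-irrefl G refl aa

record Orientation {n : ℕ} (G : Graph n) : Set₁ where
  field
    Arc      : Rel (Fin n) 0ℓ
    arc⇒adj  : ∀ {u v} → Arc u v → Adj G u v
    adj⇒arc  : ∀ {u v} → Adj G u v → Arc u v ⊎ Arc v u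
    arc-asym : Asymmetric Arc

open Orientation public

module _ {n : ℕ} {R : Rel (Fin n) 0ℓ} where

  vertices : ∀ {u v} → Star R u v → List (Fin n)
  vertices {u} ε       = u ∷ []
  vertices {u} (_ ◅ w) = u ∷ vertices w

  -- The number of arcs.
  length : ∀ {u v} → Star R u v → ℕ
  length ε       = 0
  length (_ ◅ w) = suc (length w)

module _ {n : ℕ} {G : Graph n} (D : Orientation G) where

  DiPath : Rel (Fin n) 0ℓ
  DiPath u v = Σ[ w ∈ Star (Arc D) u v ] Unique (vertices w)

  Strong : Set
  Strong = ∀ u v → DiPath u v

  IsGeodesic : ∀ {u v} → DiPath u v → Set
  IsGeodesic {u} {v} p = (q : DiPath u v) → length (proj₁ p) ≤ length (proj₁ q)

  OnGeodesic : Fin n → Fin n → Fin n → Set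
  OnGeodesic u v x = Σ[ p ∈ DiPath u v ] (IsGeodesic p × x ∈ˡ vertices (proj₁ p))

  Convex : Pred (Subset n) 0ℓ
  Convex S = Nonempty S ×
    (∀ {u v x} → u ∈ S → v ∈ S → OnGeodesic u v x ⊎ OnGeodesic v u x → x ∈ S)

  ProperConvex : Pred (Subset n) 0ℓ
  ProperConvex S = Convex S × S ≢ ⊤

  -- con(D) ≡ k, as a relation: k is the maximum of ∣ S ∣ over proper convex S.
  IsConvexityNumber : Pred ℕ 0ℓ
  IsConvexityNumber k =
    (∃[ S ] (ProperConvex S × ∣ S ∣ ≡ k)) × (∀ S → ProperConvex S → ∣ S ∣ ≤ k)

S-SC : ∀ {n} → Graph n → Pred ℕ _
S-SC G k = Σ[ D ∈ Orientation G ] (Strong D × IsConvexityNumber D k)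

{-# OPTIONS --safe #-}
module Submission where

-- In a strong orientation of the ladder the two horizontal edges between consecutive columns
-- point in opposite directions. A convex set with at least two vertices is strongly connected,
-- hence a union of at least two columns; this gives 1 or an even number other than 2. For the lower
-- bound, cut the ladder between two columns: the part on one side is convex as soon as its
-- rung next to the cut closes a short way from its exit to its entry, so if no large part is
-- convex, then a middle square is a directed 4-cycle, and this property spreads to both ends. In
-- such an orientation each rung of a square lies on a geodesic between the ends of the other one,
-- so that a convex set with two vertices is everything. Conversely, 1 is realised by making all
-- squares directed 4-cycles, and 2j by making the two parts of the ladder left and right of
-- column n - 1 - j directed cycles, all of whose inner rungs are parallel.

open import Defs
open import Data.Nat.Base using (ℕ; zero; suc; _+_; _*_; _∸_; _⊓_; _≤_; _<_; _≤ᵇ_; _<ᵇ_; z≤n; s≤s; s≤s⁻¹; ⌊_/2⌋; ⌈_/2⌉) renaming (∣_-_∣ to gap)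
open import Data.Nat.Properties using (≤-refl; ≤-trans; ≤-reflexive; +-mono-≤; +-monoˡ-≤; +-monoʳ-≤; n≤0⇒n≡0; 1+n≰n; n≤1+n; m≤n⇒m≤1+n; module ≤-Reasoning)
import Data.Nat.Properties as ℕ
open import Data.Nat.Solver using (module +-*-Solver)
open import Data.Bool.Base using (Bool; true; false; not; _∧_; _∨_)
open import Data.Bool.Properties using (not-involutive; ¬-not; not-¬)
import Data.Bool.Properties as Bool
open import Data.Empty using (⊥-elim)
open import Data.Fin.Base using (Fin; zero; suc; toℕ; fromℕ<; combine; remQuot)
open import Data.Fin.Properties using (any?; toℕ<n; toℕ-injective; toℕ-fromℕ<; fromℕ<-toℕ; remQuot-combine; combine-remQuot)
import Data.Fin.Properties as Fin
open import Data.Fin.Subset using (Subset; _∈_; _∉_; _⊆_; ∣_∣; Nonempty; ⊤; ⁅_⁆; ∁; _-_)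
open import Data.Fin.Subset.Properties using (_∈?_; x∉p⇒x∈∁p; x∈∁p⇒x∉p; ∣∁p∣≡n∸∣p∣; ∈⊤; ⊆⊤; ⊆-antisym; x∈⁅x⁆; x∈⁅y⁆⇒x≡y; ∣⁅x⁆∣≡1; ∣p∣≤n; p⊆q⇒∣p∣≤∣q∣; ∣p∣≡n⇒p≡⊤; x∈p∧x≢y⇒x∈p-y; x∈p⇒∣p-x∣<∣p∣)
open import Data.List.Membership.Propositional using () renaming (_∈_ to _∈ˡ_)
open import Data.List.Relation.Unary.Any using (here; there)
open import Data.List.Relation.Unary.All.Properties.Core using (¬Any⇒All¬)
open import Data.List.Relation.Unary.AllPairs using ([]; _∷_)
import Data.List.Relation.Unary.All as All
open import Data.List.Relation.Unary.Unique.Propositional using (Unique)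
open import Data.Product.Base using (Σ-syntax; ∃; ∃-syntax; ∃₂; _×_; _,_; proj₁; proj₂)
open import Data.Sum.Base using (_⊎_; inj₁; inj₂)
open import Data.Vec.Base using ([]; _∷_; tabulate; lookup)
open import Data.Vec.Properties using (lookup∘tabulate; []=⇒lookup; lookup⇒[]=)
open import Function.Base using (_∘_; _$_; case_of_)
open import Function.Bundles using (Equivalence)
open import Level using (0ℓ)
open import Relation.Binary.Construct.Closure.ReflexiveTransitive using (Star; ε; _◅_; _◅◅_)
open import Relation.Binary.Core using (Rel)
open import Relation.Binary.Definitions using (tri<; tri≈; tri>) renaming (Decidable to Decidable₂)
open import Relation.Binary.PropositionalEquality using (_≡_; _≢_; refl; sym; trans; cong; cong₂; subst; subst₂)
open import Relation.Nullary using (Dec; yes; no; ¬_; contradiction; decidable-stable; map′; _×-dec_; _⊎-dec_; ¬?)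
open import Relation.Unary using (Pred; Decidable; _≐_; _∪_; _∖_; ｛_｝)

-- Minimal witnesses and walks.

least : ∀ {P : Pred ℕ 0ℓ} → Decidable P → ∀ n → P n → ∃[ m ] (P m × (∀ {k} → P k → m ≤ k))
least P? zero p = 0 , p , λ _ → z≤n
least P? (suc n) p with P? 0
... | yes p₀ = 0 , p₀ , λ _ → z≤n
... | no ¬p₀ with m , pm , min ← least (P? ∘ suc) n p =
  suc m , pm , λ { {zero} p₀ → contradiction p₀ ¬p₀ ; {suc _} pk → s≤s (min pk) }

module _ {N : ℕ} {R : Rel (Fin N) 0ℓ} where

  length-◅◅ : ∀ {u v w} (p : Star R u v) (q : Star R v w) → length (p ◅◅ q) ≡ length p + length q
  length-◅◅ ε       q = refl
  length-◅◅ (_ ◅ p) q = cong suc (length-◅◅ p q)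

  head∈vertices : ∀ {u v} (p : Star R u v) → u ∈ˡ vertices p
  head∈vertices ε       = here refl
  head∈vertices (_ ◅ _) = here refl

  ∈-vertices-◅◅ : ∀ {u v w x} (p : Star R u v) {q : Star R v w} → x ∈ˡ vertices q → x ∈ˡ vertices (p ◅◅ q)
  ∈-vertices-◅◅ ε       x∈ = x∈
  ∈-vertices-◅◅ (_ ◅ p) x∈ = there (∈-vertices-◅◅ p x∈)

  split : ∀ {u v x} (p : Star R u v) → x ∈ˡ vertices p →
    Σ[ q ∈ Star R u x ] Σ[ q′ ∈ Star R x v ] length q + length q′ ≡ length p
  split ε       (here refl) = ε , ε , refl
  split (a ◅ p) (here refl) = ε , a ◅ p , refl
  split (a ◅ p) (there x∈)  with q , q′ , eq ← split p x∈ = a ◅ q , q′ , cong suc eq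

  walk? : Decidable₂ R → ∀ ℓ u v → Dec (Σ[ w ∈ Star R u v ] length w ≡ ℓ)
  walk? R? zero u v = map′ (λ { refl → ε , refl }) (λ { (ε , _) → refl }) (u Fin.≟ v)
  walk? R? (suc ℓ) u v = map′
    (λ { (_ , a , w , eq) → a ◅ w , cong suc eq })
    (λ { (a ◅ w , eq) → _ , a , w , ℕ.suc-injective eq })
    (any? λ x → R? u x ×-dec walk? R? ℓ x v)

-- Distances in a strong orientation, and convexity in terms of them.

module Geodesics {N : ℕ} {G : Graph N} (D : Orientation G)
                 (arc? : Decidable₂ (Arc D)) (reach : ∀ u v → Star (Arc D) u v) where

  private
    shortest : ∀ u v → ∃[ ℓ ] ((Σ[ w ∈ Star (Arc D) u v ] length w ≡ ℓ)
                        × (∀ {k} → (Σ[ w ∈ Star (Arc D) u v ] length w ≡ k) → ℓ ≤ k))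
    shortest u v = least (λ ℓ → walk? arc? ℓ u v) _ (reach u v , refl)

  abstract
    d : Fin N → Fin N → ℕ
    d u v = proj₁ (shortest u v)

    geodesic : ∀ u v → Σ[ w ∈ Star (Arc D) u v ] length w ≡ d u v
    geodesic u v = proj₁ (proj₂ (shortest u v))

    d≤length : ∀ {u v} (w : Star (Arc D) u v) → d u v ≤ length w
    d≤length {u} {v} w = proj₂ (proj₂ (shortest u v)) (w , refl)

  d-refl : ∀ u → d u u ≡ 0
  d-refl u = n≤0⇒n≡0 (d≤length ε)

  d-arc : ∀ {u v} → Arc D u v → d u v ≤ 1
  d-arc a = d≤length (a ◅ ε)

  d-triangle : ∀ u v w → d u w ≤ d u v + d v w
  d-triangle u v w with p , eq ← geodesic u v | q , eq′ ← geodesic v w =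
    subst (d u w ≤_) (trans (length-◅◅ p q) (cong₂ _+_ eq eq′)) (d≤length (p ◅◅ q))

  1≤d : ∀ {u v} → u ≢ v → 1 ≤ d u v
  1≤d {u} {v} u≢v with geodesic u v
  ... | ε     , _  = contradiction refl u≢v
  ... | _ ◅ _ , eq = subst (1 ≤_) eq (s≤s z≤n)

  3≤d : ∀ {u v} → u ≢ v → ¬ Arc D u v → (∀ {x} → Arc D u x → ¬ Arc D x v) → 3 ≤ d u v
  3≤d {u} {v} u≢v ¬a ¬aa with geodesic u v
  ... | ε             , _  = contradiction refl u≢v
  ... | a ◅ ε         , _  = contradiction a ¬a
  ... | a ◅ b ◅ ε     , _  = contradiction b (¬aa a)
  ... | _ ◅ _ ◅ _ ◅ _ , eq = subst (3 ≤_) eq (s≤s (s≤s (s≤s z≤n)))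

  d-potential : (f : Fin N → ℕ) → (∀ {x y} → Arc D x y → f x ≤ suc (f y)) →
                ∀ u v → f u ≤ d u v + f v
  d-potential f f-arc u v with w , eq ← geodesic u v = subst (λ ℓ → f u ≤ ℓ + f v) eq (go w)
    where
    go : ∀ {u} (w : Star (Arc D) u v) → f u ≤ length w + f v
    go ε       = ≤-refl
    go (a ◅ w) = ≤-trans (f-arc a) (s≤s (go w))

  -- A return to the start could be cut off, giving a walk shorter than the distance. So shortest
  -- walks are paths, and the geodesics of the definition can be measured by `d`, which is defined
  -- through walks.
  geodesic-unique : ∀ {u v} (w : Star (Arc D) u v) → length w ≤ d u v → Unique (vertices w)
  geodesic-unique ε _ = All.[] ∷ []
  geodesic-unique {u} {v} (_◅_ {j = x} a w) le =
    ¬Any⇒All¬ _ no-return ∷ geodesic-unique w (s≤s⁻¹ (≤-trans le d≤1+d))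
    where
    d≤1+d : d u v ≤ suc (d x v)
    d≤1+d = ≤-trans (d-triangle u x v) (+-monoˡ-≤ _ (d-arc a))

    no-return : ¬ (u ∈ˡ vertices w)
    no-return u∈ with q , q′ , eq ← split w u∈ = 1+n≰n $ begin
      suc (length w)       ≤⟨ le ⟩
      d u v                ≤⟨ d≤length q′ ⟩
      length q′            ≤⟨ ℕ.m≤n+m _ (length q) ⟩
      length q + length q′ ≡⟨ eq ⟩
      length w             ∎
      where open ≤-Reasoning

  strong : Strong D
  strong u v with w , eq ← geodesic u v = w , geodesic-unique w (≤-reflexive eq)

  -- Convexity without paths: `x` lies on a geodesic from `u` to `v` exactly when the triangle
  -- inequality is tight at `x`. Ranging over all ordered pairs covers both directions.
  Closed : Subset N → Set
  Closed S = ∀ {u v x} → u ∈ S → v ∈ S → d u x + d x v ≤ d u v → x ∈ S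

  onGeodesic⇒d : ∀ {u v x} → OnGeodesic D u v x → d u x + d x v ≤ d u v
  onGeodesic⇒d {u} {v} {x} ((p , _) , geo , x∈) with q , q′ , eq ← split p x∈ = begin
    d u x + d x v        ≤⟨ +-mono-≤ (d≤length q) (d≤length q′) ⟩
    length q + length q′ ≡⟨ eq ⟩
    length p             ≤⟨ geo (strong u v) ⟩
    length (proj₁ (strong u v)) ≡⟨ proj₂ (geodesic u v) ⟩
    d u v                ∎
    where open ≤-Reasoning

  d⇒onGeodesic : ∀ {u v x} → d u x + d x v ≤ d u v → OnGeodesic D u v x
  d⇒onGeodesic {u} {v} {x} le with p , eq ← geodesic u x | q , eq′ ← geodesic x v =
    (p ◅◅ q , geodesic-unique (p ◅◅ q) short) ,
    (λ (w , _) → ≤-trans short (d≤length w)) ,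
    ∈-vertices-◅◅ p (head∈vertices q)
    where
    short : length (p ◅◅ q) ≤ d u v
    short = subst (_≤ d u v) (sym (trans (length-◅◅ p q) (cong₂ _+_ eq eq′))) le

  convex⇒closed : ∀ {S} → Convex D S → Closed S
  convex⇒closed (_ , conv) u∈ v∈ le = conv u∈ v∈ (inj₁ (d⇒onGeodesic le))

  closed⇒convex : ∀ {S} → Nonempty S → Closed S → Convex D S
  closed⇒convex ne cl = ne , λ where
    u∈ v∈ (inj₁ geo) → cl u∈ v∈ (onGeodesic⇒d geo)
    u∈ v∈ (inj₂ geo) → cl v∈ u∈ (onGeodesic⇒d geo)

  singleton-closed : ∀ u → Closed ⁅ u ⁆
  singleton-closed u {x = x} u′∈ v∈ le
    with refl ← x∈⁅y⁆⇒x≡y u u′∈ | refl ← x∈⁅y⁆⇒x≡y u v∈ | x Fin.≟ u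
  ... | yes refl = x∈⁅x⁆ u
  ... | no x≢u = contradiction (≤-trans (≤-trans (1≤d x≢u) (ℕ.m≤n+m _ (d u x))) le)
                               (λ 1≤ → 1+n≰n (subst (1 ≤_) (d-refl u) 1≤))

  module _ {P : Pred (Fin N) 0ℓ} (P? : Decidable P) where

    private
      cross-walk : ∀ {u v} (w : Star (Arc D) u v) → P u → ¬ P v →
        ∃₂ λ x y → Arc D x y × P x × ¬ P y × d u x + (1 + d y v) ≤ length w
      cross-walk ε pu ¬pv = contradiction pu ¬pv
      cross-walk {u} {v} (_◅_ {j = z} a w) pu ¬pv with P? z
      ... | no ¬pz = u , z , a , pu , ¬pz ,
            subst (λ ℓ → ℓ + (1 + d z v) ≤ suc (length w)) (sym (d-refl u)) (s≤s (d≤length w))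
      ... | yes pz with x , y , b , px , ¬py , le ← cross-walk w pz ¬pv =
            x , y , b , px , ¬py , (begin
              d u x + (1 + d y v)           ≤⟨ +-monoˡ-≤ _ (d-triangle u z x) ⟩
              d u z + d z x + (1 + d y v)   ≤⟨ +-monoˡ-≤ _ (+-monoˡ-≤ _ (d-arc a)) ⟩
              suc (d z x + (1 + d y v))     ≤⟨ s≤s le ⟩
              suc (length w)                ∎)
            where open ≤-Reasoning

    -- Take the first arc by which a geodesic leaves `P`; the inequality records that this arc lies
    -- on a geodesic from `u` to `v`.
    cross : ∀ {u v} → P u → ¬ P v →
      ∃₂ λ x y → Arc D x y × P x × ¬ P y × d u x + (1 + d y v) ≤ d u v
    cross {u} {v} pu ¬pv with w , eq ← geodesic u v = subst
      (λ ℓ → ∃₂ λ x y → Arc D x y × P x × ¬ P y × d u x + (1 + d y v) ≤ ℓ) eq (cross-walk w pu ¬pv)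

    -- Both ends of the arc found by `cross` lie on a geodesic between members of `S`. This is the
    -- form in which strong connectivity of convex sets is used.
    cross-closed : ∀ {S} → Closed S → ∀ {u v} → u ∈ S → v ∈ S → P u → ¬ P v →
      ∃₂ λ x y → Arc D x y × P x × ¬ P y × x ∈ S × y ∈ S
    cross-closed cl {u} {v} u∈ v∈ pu ¬pv
      with x , y , a , px , ¬py , le ← cross pu ¬pv =
      x , y , a , px , ¬py ,
      cl u∈ v∈ (≤-trans (+-monoʳ-≤ (d u x)
        (≤-trans (d-triangle x y v) (+-monoˡ-≤ _ (d-arc a)))) le) ,
      cl u∈ v∈ (≤-trans (+-monoˡ-≤ _
        (≤-trans (d-triangle u x y) (+-monoʳ-≤ _ (d-arc a))))
        (≤-trans (≤-reflexive (ℕ.+-assoc (d u x) 1 (d y v))) le))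

  -- The first arc leaving the one-point predicate "equal to `u`" starts at `u` and stays in `S`.
  out-neighbour : ∀ {S} → Closed S → ∀ {u v} → u ∈ S → v ∈ S → u ≢ v → ∃[ y ] (Arc D u y × y ∈ S)
  out-neighbour cl {u} u∈ v∈ u≢v
    with x , y , a , refl , _ , _ , y∈ ← cross-closed (u Fin.≟_) cl u∈ v∈ refl u≢v = y , a , y∈

  -- An excursion of a geodesic out of S runs from p over p′ and q′ back to q, so it has
  -- length at least 2 + d p′ q′, whereas d p q is smaller.
  pocket-closed : ∀ {S p p′ q q′} →
    (∀ {u v} → Arc D u v → u ∈ S → v ∉ S → u ≡ p × v ≡ p′) →
    (∀ {u v} → Arc D u v → u ∉ S → v ∈ S → u ≡ q′ × v ≡ q) →
    d p q ≤ 1 + d p′ q′ → Closed S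
  pocket-closed {S} {p} {p′} {q} {q′} exit entry short {u} {v} {x} u∈ v∈ le with x ∈? S
  ... | yes x∈ = x∈
  ... | no x∉
    with _ , _ , a , p∈ , p′∉ , le₁ ← cross (_∈? S) u∈ x∉
       | _ , _ , b , q′∉ , ¬q∉ , le₂ ← cross (λ w → ¬? (w ∈? S)) x∉ (λ ∉ → ∉ v∈)
    with q∈ ← decidable-stable (_ ∈? S) ¬q∉
    with refl , refl ← exit a p∈ p′∉ | refl , refl ← entry b q′∉ q∈ = contradiction (begin
      1 + (d u p + (1 + d p′ q′) + d q v)                ≤⟨ s≤s (+-monoˡ-≤ _ (+-monoʳ-≤ (d u p) (s≤s (d-triangle p′ x q′)))) ⟩
      1 + (d u p + (1 + (d p′ x + d x q′)) + d q v)      ≡⟨ rearrange (d u p) (d p′ x) (d x q′) (d q v) ⟩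
      d u p + (1 + d p′ x) + (d x q′ + (1 + d q v))      ≤⟨ +-mono-≤ le₁ le₂ ⟩
      d u x + d x v                                      ≤⟨ le ⟩
      d u v                                              ≤⟨ d-triangle u q v ⟩
      d u q + d q v                                      ≤⟨ +-monoˡ-≤ _ (d-triangle u p q) ⟩
      d u p + d p q + d q v                              ≤⟨ +-monoˡ-≤ _ (+-monoʳ-≤ (d u p) short) ⟩
      d u p + (1 + d p′ q′) + d q v                      ∎) 1+n≰n
    where
    open ≤-Reasoning
    open +-*-Solver
    rearrange : ∀ a b c e → 1 + (a + (1 + (b + c)) + e) ≡ a + (1 + b) + (c + (1 + e))
    rearrange = solve 4 (λ a b c e → con 1 :+ (a :+ (con 1 :+ (b :+ c)) :+ e)
                                  := a :+ (con 1 :+ b) :+ (c :+ (con 1 :+ e))) refl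

-- Decidability of arcs, and choice over a range of indices.

P-adj? : ∀ {m} → Decidable₂ (Adj (P m))
P-adj? i j = (suc (toℕ i) ℕ.≟ toℕ j) ⊎-dec (suc (toℕ j) ℕ.≟ toℕ i)

□-adj? : ∀ {m n} {G : Graph m} {H : Graph n} →
  Decidable₂ (Adj G) → Decidable₂ (Adj H) → Decidable₂ (Adj (G □ H))
□-adj? {m} {n} G? H? u v =
  let a , b = remQuot {m} n u
      c , e = remQuot {m} n v
  in (a Fin.≟ c ×-dec H? b e) ⊎-dec (G? a c ×-dec b Fin.≟ e)

orientation-arc? : ∀ {m} {G : Graph m} (D : Orientation G) → Decidable₂ (Adj G) → Decidable₂ (Arc D)
orientation-arc? D adj? u v with adj? u v
... | no ¬e = no (¬e ∘ arc⇒adj D)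
... | yes e with adj⇒arc D e
... | inj₁ a = yes a
... | inj₂ a = no (arc-asym D a)

choose : ∀ {B : ℕ → Set} {Q : ℕ → Bool → Set} → (∀ i → Dec (B i)) →
  (∀ i → B i → ∃ (Q i)) → Σ[ f ∈ (ℕ → Bool) ] (∀ i → B i → Q i (f i))
choose {B} {Q} B? ex = (λ i → proj₁ (pick i)) , λ i → proj₂ (pick i)
  where
  pick : ∀ i → Σ[ s ∈ Bool ] (B i → Q i s)
  pick i with B? i
  ... | yes b with s , q ← ex i b = s , λ _ → q
  -- A default value: nothing is claimed outside `B`.
  ... | no ¬b = true , λ b → contradiction b ¬b

-- Ladder coordinates and oriented steps.

bit : Bool → Fin 2
bit true  = zero
bit false = suc zero

unbit : Fin 2 → Bool
unbit zero    = true
unbit (suc _) = false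

unbit-bit : ∀ s → unbit (bit s) ≡ s
unbit-bit true  = refl
unbit-bit false = refl

bit-unbit : ∀ b → bit (unbit b) ≡ b
bit-unbit zero       = refl
bit-unbit (suc zero) = refl

-- Adjacency in coordinates. Rows are Booleans, so that changing the row is `not`; row conditions
-- are equations instead of indices because unification gets stuck on an index such as `not t`.
data Edge : ℕ → Bool → ℕ → Bool → Set where
  right : ∀ {i s t} → s ≡ t → Edge i s (suc i) t
  left  : ∀ {i s t} → s ≡ t → Edge (suc i) s i t
  rung  : ∀ {i s t} → s ≡ not t → Edge i s i t

-- h i is the row directed from column i to column i + 1 (the other row is directed back),
-- r i is the row of the tail of the rung in column i.
data Step (h r : ℕ → Bool) : ℕ → Bool → ℕ → Bool → Set where
  right : ∀ {i s t} → s ≡ h i → t ≡ s → Step h r i s (suc i) t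
  left  : ∀ {i s t} → s ≡ not (h i) → t ≡ s → Step h r (suc i) s i t
  rung  : ∀ {i s t} → s ≡ r i → t ≡ not s → Step h r i s i t

step⇒edge : ∀ {h r i s j t} → Step h r i s j t → Edge i s j t
step⇒edge (right _ refl) = right refl
step⇒edge (left _ refl)  = left refl
step⇒edge (rung _ refl)  = rung (sym (not-involutive _))

edge⇒step : ∀ {h r i s j t} → Edge i s j t → Step h r i s j t ⊎ Step h r j t i s
edge⇒step {h} {i = i} {s} (right refl) with s Bool.≟ h i
... | yes eq = inj₁ (right eq refl)
... | no neq = inj₂ (left (¬-not neq) refl)
edge⇒step {h} {s = s} {j} (left refl) with s Bool.≟ h j
... | yes eq = inj₂ (right eq refl)
... | no neq = inj₁ (left (¬-not neq) refl)
edge⇒step {r = r} {i} {s} {t = t} (rung refl) with s Bool.≟ r i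
... | yes eq = inj₁ (rung eq (sym (not-involutive t)))
... | no neq = inj₂ (rung (trans (sym (not-involutive t)) (trans (cong not (¬-not neq)) (not-involutive _))) refl)

step-asym : ∀ {h r i s j t} → Step h r i s j t → ¬ Step h r j t i s
step-asym (right refl refl) (left eq _)  = not-¬ refl eq
step-asym (left eq refl)    (right refl _) = not-¬ refl eq
step-asym (rung refl eq)    (rung eq′ _)   = not-¬ eq′ eq

-- Rungs stay within a column and horizontal steps move by one, so each cut between consecutive
-- columns is crossed by a single arc in this direction, and by `down-crossing` by a single arc
-- back.
up-crossing : ∀ {h r m i s j t} → Step h r i s j t → i ≤ m → m < j → i ≡ m × j ≡ suc m × s ≡ h m × t ≡ h m
up-crossing (right refl refl) i≤ <j with refl ← ℕ.≤-antisym i≤ (s≤s⁻¹ <j) = refl , refl , refl , refl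
up-crossing (left _ _)        i≤ <j = contradiction (≤-trans (m≤n⇒m≤1+n <j) i≤) 1+n≰n
up-crossing (rung _ _)        i≤ <j = contradiction (≤-trans <j i≤) 1+n≰n

down-crossing : ∀ {h r m i s j t} → Step h r i s j t → m < i → j ≤ m →
  i ≡ suc m × j ≡ m × s ≡ not (h m) × t ≡ not (h m)
down-crossing (left refl refl) <i j≤ with refl ← ℕ.≤-antisym j≤ (s≤s⁻¹ <i) = refl , refl , refl , refl
down-crossing (right _ _)      <i j≤ = contradiction (≤-trans (m≤n⇒m≤1+n <i) j≤) 1+n≰n
down-crossing (rung _ _)       <i j≤ = contradiction (≤-trans <i j≤) 1+n≰n

edge-crossing : ∀ {m i s j t} → Edge i s j t → i ≤ m → m < j → i ≡ m × j ≡ suc m × s ≡ t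
edge-crossing (right eq) i≤ <j with refl ← ℕ.≤-antisym i≤ (s≤s⁻¹ <j) = refl , refl , eq
edge-crossing (left eq)  i≤ <j = contradiction (≤-trans (m≤n⇒m≤1+n <j) i≤) 1+n≰n
edge-crossing (rung eq)  i≤ <j = contradiction (≤-trans <j i≤) 1+n≰n

edge-sym : ∀ {i s j t} → Edge i s j t → Edge j t i s
edge-sym (right eq) = left (sym eq)
edge-sym (left eq)  = right (sym eq)
edge-sym (rung refl) = rung (sym (not-involutive _))

-- Orientations of the ladder coded by two Boolean sequences.

module Grid (n : ℕ) where

  col : Fin (n * 2) → ℕ
  col v = toℕ (proj₁ (remQuot {n} 2 v))

  row : Fin (n * 2) → Bool
  row v = unbit (proj₂ (remQuot {n} 2 v))

  col<n : ∀ v → col v < n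
  col<n v = toℕ<n (proj₁ (remQuot {n} 2 v))

  vt : ∀ i → .(i < n) → Bool → Fin (n * 2)
  vt i i<n s = combine (fromℕ< i<n) (bit s)

  col-vt : ∀ i .(p : i < n) s → col (vt i p s) ≡ i
  col-vt i p s = trans (cong (toℕ ∘ proj₁) (remQuot-combine {n} {2} (fromℕ< p) (bit s))) (toℕ-fromℕ< p)

  row-vt : ∀ i .(p : i < n) s → row (vt i p s) ≡ s
  row-vt i p s = trans (cong (unbit ∘ proj₂) (remQuot-combine {n} {2} (fromℕ< p) (bit s))) (unbit-bit s)

  vt-unique : ∀ v {i s} .(p : i < n) → col v ≡ i → row v ≡ s → v ≡ vt i p s
  vt-unique v p refl refl = sym (trans
    (cong₂ combine (fromℕ<-toℕ (proj₁ (remQuot {n} 2 v)) p) (bit-unbit (proj₂ (remQuot {n} 2 v))))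
    (combine-remQuot {n} 2 v))

  vt-≢ : ∀ {i s} .(p : i < n) → vt i p s ≢ vt i p (not s)
  vt-≢ {i} {s} p eq = not-¬ refl (trans (sym (row-vt i p s)) (trans (cong row eq) (row-vt i p (not s))))

  adj⇒edge : ∀ {u v} → Adj (P n □ P 2) u v → Edge (col u) (row u) (col v) (row v)
  adj⇒edge {u} {v} = pairs _ _ _ _
    where
    pairs : ∀ (a : Fin n) b c e → □-Adj (P n) (P 2) (a , b) (c , e) → Edge (toℕ a) (unbit b) (toℕ c) (unbit e)
    pairs a zero       _ zero       (inj₁ (refl , inj₁ ()))
    pairs a zero       _ zero       (inj₁ (refl , inj₂ ()))
    pairs a zero       _ (suc zero) (inj₁ (refl , _)) = rung refl
    pairs a (suc zero) _ zero       (inj₁ (refl , _)) = rung refl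
    pairs a (suc zero) _ (suc zero) (inj₁ (refl , inj₁ ()))
    pairs a (suc zero) _ (suc zero) (inj₁ (refl , inj₂ ()))
    pairs a b c _ (inj₂ (inj₁ eq , refl)) = subst (λ j → Edge (toℕ a) _ j _) eq (right refl)
    pairs a b c _ (inj₂ (inj₂ eq , refl)) = subst (λ i → Edge i _ (toℕ c) _) eq (left refl)

  edge⇒adj : ∀ {u v} → Edge (col u) (row u) (col v) (row v) → Adj (P n □ P 2) u v
  edge⇒adj {u} {v} edge = pairs _ _ _ _ edge refl refl refl refl
    where
    same-row : ∀ {b e} → unbit b ≡ unbit e → b ≡ e
    same-row {b} {e} eq = trans (sym (bit-unbit b)) (trans (cong bit eq) (bit-unbit e))

    opposite : ∀ b e → unbit b ≡ not (unbit e) → Adj (P 2) b e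
    opposite zero       zero       ()
    opposite zero       (suc zero) _ = inj₁ refl
    opposite (suc zero) zero       _ = inj₂ refl
    opposite (suc zero) (suc zero) ()

    pairs : ∀ (a : Fin n) b c e {i s j t} → Edge i s j t → toℕ a ≡ i → unbit b ≡ s → toℕ c ≡ j → unbit e ≡ t →
      □-Adj (P n) (P 2) (a , b) (c , e)
    pairs a b c e (right refl) refl refl cj et = inj₂ (inj₁ (sym cj) , same-row (sym et))
    pairs a b c e (left refl)  ai bs refl refl = inj₂ (inj₂ (sym ai) , same-row bs)
    pairs a b c e (rung st)    ai refl cj refl = inj₁ (toℕ-injective (trans ai (sym cj)) , opposite b e st)

  ladder : (h r : ℕ → Bool) → Orientation (P n □ P 2)
  ladder h r .Arc u v = Step h r (col u) (row u) (col v) (row v)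
  ladder h r .arc⇒adj a = edge⇒adj (step⇒edge a)
  ladder h r .adj⇒arc e = edge⇒step (adj⇒edge e)
  ladder h r .arc-asym = step-asym

  grid-arc? : (D : Orientation (P n □ P 2)) → Decidable₂ (Arc D)
  grid-arc? D = orientation-arc? D (□-adj? {G = P n} {H = P 2} P-adj? P-adj?)

  -- A common interface for the explicit orientations `ladder h r` and for arbitrary strong ones,
  -- which get their code from `strong⇒ladder`.
  record IsLadder (D : Orientation (P n □ P 2)) (h r : ℕ → Bool) : Set where
    field
      arc⇒step : ∀ {u v} → Arc D u v → Step h r (col u) (row u) (col v) (row v)
      step⇒arc : ∀ {u v} → Step h r (col u) (row u) (col v) (row v) → Arc D u v

    arc : ∀ {i s j t} .(p : i < n) .(q : j < n) → Step h r i s j t → Arc D (vt i p s) (vt j q t)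
    arc {i} {s} {j} {t} p q st = step⇒arc (subst₂ (λ (i , s) (j , t) → Step h r i s j t)
      (sym (cong₂ _,_ (col-vt i p s) (row-vt i p s))) (sym (cong₂ _,_ (col-vt j q t) (row-vt j q t))) st)

  module _ (D : Orientation (P n □ P 2)) (strong : Strong D) where

    open Geodesics D (grid-arc? D) (λ u v → proj₁ (strong u v)) using (cross)

    private
      Horizontal : ℕ → Bool → Set
      Horizontal i s = (q : suc i < n) →
        Arc D (vt i (ℕ.<⇒≤ q) s) (vt (suc i) q s) × Arc D (vt (suc i) q (not s)) (vt i (ℕ.<⇒≤ q) (not s))

      Vertical : ℕ → Bool → Set
      Vertical i s = .(p : i < n) → Arc D (vt i p s) (vt i p (not s))

      -- If the arcs across the cut in the two directions used the same row, they would be the same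
      -- edge oriented both ways. So they use different rows and account for both horizontal edges.
      opposite-arcs : ∀ {i x y x′ y′} → suc i < n → Arc D x y → Arc D y′ x′ →
        col x ≤ i → i < col y → i < col y′ → col x′ ≤ i → ∃ (Horizontal i)
      opposite-arcs {i} {x} {y} {x′} {y′} q a a′ x≤ <y <y′ x′≤ =
        let cx , cy , xy = edge-crossing (adj⇒edge (arc⇒adj D a)) x≤ <y
            cx′ , cy′ , xy′ = edge-crossing (edge-sym (adj⇒edge (arc⇒adj D a′))) x′≤ <y′
            p = ℕ.<⇒≤ q
        in case row y′ Bool.≟ row x of λ where
          (yes eq) → contradiction
            (subst₂ (Arc D) (trans (vt-unique y′ q cy′ (trans eq xy)) (sym (vt-unique y q cy refl)))
              (trans (vt-unique x′ p cx′ (trans xy′ eq)) (sym (vt-unique x p cx refl))) a′)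
            (arc-asym D a)
          (no neq) → row x , λ _ →
            subst₂ (Arc D) (vt-unique x p cx refl) (vt-unique y q cy (sym xy)) a ,
            subst₂ (Arc D) (vt-unique y′ q cy′ (¬-not neq)) (vt-unique x′ p cx′ (trans xy′ (¬-not neq))) a′

      horizontal : ∀ i → suc i < n → ∃ (Horizontal i)
      horizontal i q =
        let p = ℕ.<⇒≤ q
            near≤ = ≤-reflexive (col-vt i p true)
            <far = ≤-reflexive (sym (col-vt (suc i) q true))
            -- Strong connectivity forces an arc across the cut each way; the row `true` of the
            -- chosen end vertices is arbitrary.
            _ , _ , a , x≤ , y≰ , _ = cross (λ v → col v ℕ.≤? i) near≤ (ℕ.<⇒≱ <far)
            _ , _ , a′ , <y′ , ≮x′ , _ = cross (λ v → i ℕ.<? col v) <far (ℕ.≤⇒≯ near≤)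
        in opposite-arcs q a a′ x≤ (ℕ.≰⇒> y≰) <y′ (ℕ.≮⇒≥ ≮x′)

      vertical : ∀ i → i < n → ∃ (Vertical i)
      vertical i p with adj⇒arc D {vt i p true} {vt i p false}
        (edge⇒adj (subst₂ (λ (i , s) (j , t) → Edge i s j t)
          (sym (cong₂ _,_ (col-vt i p true) (row-vt i p true)))
          (sym (cong₂ _,_ (col-vt i p false) (row-vt i p false))) (rung refl)))
      ... | inj₁ a = true , λ _ → a
      ... | inj₂ a = false , λ _ → a

    strong⇒ladder : ∃₂ (IsLadder D)
    strong⇒ladder
      with h , hor ← choose (λ i → suc i ℕ.<? n) horizontal
         | r , ver ← choose (λ i → i ℕ.<? n) vertical
      = h , r , record { arc⇒step = to ; step⇒arc = from refl refl refl refl }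
      where
      from : ∀ {u v i s j t} → col u ≡ i → row u ≡ s → col v ≡ j → row v ≡ t → Step h r i s j t → Arc D u v
      from {u} {v} cu ru cv rv (right refl refl) = subst₂ (Arc D)
        (sym (vt-unique u (subst (_< n) cu (col<n u)) cu ru)) (sym (vt-unique v (subst (_< n) cv (col<n v)) cv rv))
        (proj₁ (hor _ (subst (_< n) cv (col<n v)) (subst (_< n) cv (col<n v))))
      from {u} {v} cu ru cv rv (left refl refl) = subst₂ (Arc D)
        (sym (vt-unique u (subst (_< n) cu (col<n u)) cu ru)) (sym (vt-unique v (subst (_< n) cv (col<n v)) cv rv))
        (proj₂ (hor _ (subst (_< n) cu (col<n u)) (subst (_< n) cu (col<n u))))
      from {u} {v} cu ru cv rv (rung refl refl) = subst₂ (Arc D)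
        (sym (vt-unique u (subst (_< n) cu (col<n u)) cu ru)) (sym (vt-unique v (subst (_< n) cv (col<n v)) cv rv))
        (ver _ (subst (_< n) cv (col<n v)) _)

      -- Every edge is a step in one of its two directions; the wrong one would, by `from`, reverse
      -- the given arc.
      to : ∀ {u v} → Arc D u v → Step h r (col u) (row u) (col v) (row v)
      to {u} {v} a with edge⇒step (adj⇒edge (arc⇒adj D a))
      ... | inj₁ st = st
      ... | inj₂ st = contradiction (from {v} {u} refl refl refl refl st) (arc-asym D a)

-- Initial and final segments of columns, and counting.

pre : ∀ n → ℕ → Subset (n * 2)
pre n m = tabulate (λ v → Grid.col n v <ᵇ m)

suf : ∀ n → ℕ → Subset (n * 2)
suf n m = ∁ (pre n m)

-- The vertex numbering lists the two vertices of a column consecutively, so column 0 can be peeled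
-- off by computation.
∣pre∣ : ∀ {n m} → m ≤ n → ∣ pre n m ∣ ≡ m * 2
∣pre∣ {zero}          z≤n       = refl
∣pre∣ {suc n} {zero}  z≤n       = ∣pre∣ {n} z≤n
∣pre∣ {suc n} {suc m} (s≤s m≤n) = cong (2 +_) (∣pre∣ m≤n)

∣suf∣ : ∀ {n m} → m ≤ n → ∣ suf n m ∣ ≡ (n ∸ m) * 2
∣suf∣ {n} {m} m≤n = trans (∣∁p∣≡n∸∣p∣ (pre n m))
  (trans (cong (n * 2 ∸_) (∣pre∣ m≤n)) (sym (ℕ.*-distribʳ-∸ 2 n m)))

module _ {n m : ℕ} {v : Fin (n * 2)} where

  open Grid n

  ∈pre⁺ : col v < m → v ∈ pre n m
  ∈pre⁺ lt = lookup⇒[]= v _ (trans (lookup∘tabulate _ v) (Equivalence.to Bool.T-≡ (ℕ.<⇒<ᵇ lt)))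

  ∈pre⁻ : v ∈ pre n m → col v < m
  ∈pre⁻ v∈ = ℕ.<ᵇ⇒< _ m (Equivalence.from Bool.T-≡ (trans (sym (lookup∘tabulate _ v)) ([]=⇒lookup v∈)))

  ∈suf⁺ : m ≤ col v → v ∈ suf n m
  ∈suf⁺ le = x∉p⇒x∈∁p (λ v∈ → ℕ.<⇒≱ (∈pre⁻ v∈) le)

  ∈suf⁻ : v ∈ suf n m → m ≤ col v
  ∈suf⁻ v∈ = ℕ.≮⇒≥ (λ lt → x∈∁p⇒x∉p v∈ (∈pre⁺ lt))

  ∉pre⁻ : v ∉ pre n m → m ≤ col v
  ∉pre⁻ v∉ = ℕ.≮⇒≥ (v∉ ∘ ∈pre⁺)

  ∉suf⁻ : v ∉ suf n m → col v < m
  ∉suf⁻ v∉ = ℕ.≰⇒> (v∉ ∘ ∈suf⁺)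

count-columns : ∀ {n} (S : Subset (n * 2)) →
  (∀ (i : Fin n) → lookup S (combine i zero) ≡ lookup S (combine i (suc zero))) →
  ∣ S ∣ ≡ 2 * ∣ tabulate (λ (i : Fin n) → lookup S (combine i zero)) ∣
count-columns {zero}  []          _   = refl
count-columns {suc n} (x ∷ y ∷ S) sat with refl ← sat zero | x
... | true  = trans (cong (2 +_) (count-columns S (sat ∘ suc))) (sym (ℕ.*-suc 2 _))
... | false = count-columns S (sat ∘ suc)

nonsingleton : ∀ {N} {S : Subset N} → Nonempty S → ∣ S ∣ ≢ 1 → ∃₂ λ u v → u ∈ S × v ∈ S × u ≢ v
nonsingleton {S = S} (u , u∈) ≢1 with any? (λ v → v ∈? S ×-dec ¬? (u Fin.≟ v))
... | yes (v , v∈ , u≢v) = u , v , u∈ , v∈ , u≢v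
... | no none = contradiction (trans (cong ∣_∣ S≡⁅u⁆) (∣⁅x⁆∣≡1 u)) ≢1
  where
  S⊆⁅u⁆ : S ⊆ ⁅ u ⁆
  S⊆⁅u⁆ {x} x∈ with u Fin.≟ x
  ... | yes refl = x∈⁅x⁆ u
  ... | no u≢x = contradiction (x , x∈ , u≢x) none

  S≡⁅u⁆ : S ≡ ⁅ u ⁆
  S≡⁅u⁆ = ⊆-antisym S⊆⁅u⁆ (λ x∈ → subst (_∈ S) (sym (x∈⁅y⁆⇒x≡y u x∈)) u∈)

three-distinct : ∀ {N} {S : Subset N} {u v w} → u ∈ S → v ∈ S → w ∈ S → u ≢ v → u ≢ w → v ≢ w → 3 ≤ ∣ S ∣
three-distinct {S = S} {u} {v} {w} u∈ v∈ w∈ u≢v u≢w v≢w = begin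
  3                       ≤⟨ s≤s (s≤s (s≤s z≤n)) ⟩
  3 + ∣ S - u - v - w ∣   ≤⟨ s≤s (s≤s (x∈p⇒∣p-x∣<∣p∣ w∈′)) ⟩
  2 + ∣ S - u - v ∣       ≤⟨ s≤s (x∈p⇒∣p-x∣<∣p∣ v∈′) ⟩
  1 + ∣ S - u ∣           ≤⟨ x∈p⇒∣p-x∣<∣p∣ u∈ ⟩
  ∣ S ∣                   ∎
  where
  open ≤-Reasoning
  v∈′ : v ∈ S - u
  v∈′ = x∈p∧x≢y⇒x∈p-y v∈ (u≢v ∘ sym)
  w∈′ : w ∈ S - u - v
  w∈′ = x∈p∧x≢y⇒x∈p-y (x∈p∧x≢y⇒x∈p-y w∈ (u≢w ∘ sym)) (v≢w ∘ sym)

-- Reduces a claim about two ends of a rung to the trivial case and the two directions of the rung,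
-- relative to a row `b` that is not a constructor, such as `h i`.
Bool-pairs : ∀ (Q : Bool → Bool → Set) {b} → (∀ {s} → Q s s) → Q b (not b) → Q (not b) b → ∀ s t → Q s t
Bool-pairs Q {b} diag fwd bwd s t with s Bool.≟ t | s Bool.≟ b
... | yes refl | _        = diag
... | no s≢t   | yes refl = subst (Q s) (sym (¬-not (s≢t ∘ sym))) fwd
... | no s≢t   | no s≢b   = subst₂ Q (sym (¬-not s≢b)) b≡t bwd
  where b≡t = Bool.not-injective (trans (sym (¬-not s≢b)) (¬-not s≢t))

-- Squares that are directed 4-cycles.

module Squares {n : ℕ} {D : Orientation (P n □ P 2)} {h r : ℕ → Bool} (L : Grid.IsLadder n D h r) where

  open Grid n
  open IsLadder L

  -- The square between columns i and i + 1 is a directed 4-cycle.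
  Cyclic : ℕ → Set
  Cyclic i = r i ≡ not (h i) × r (suc i) ≡ h i

  module Square {i : ℕ} (q : suc i < n) (c : Cyclic i) where

    p : i < n
    p = ℕ.<⇒≤ q

    forth : Arc D (vt i p (h i)) (vt (suc i) q (h i))
    forth = arc p q (right refl refl)

    back : Arc D (vt (suc i) q (not (h i))) (vt i p (not (h i)))
    back = arc q p (left refl refl)

    far-rung : Arc D (vt (suc i) q (h i)) (vt (suc i) q (not (h i)))
    far-rung = arc q q (rung (sym (proj₂ c)) refl)

    near-rung : Arc D (vt i p (not (h i))) (vt i p (h i))
    near-rung = arc p p (rung (sym (proj₁ c)) (sym (not-involutive _)))

    near-around : Star (Arc D) (vt i p (h i)) (vt i p (not (h i)))
    near-around = forth ◅ far-rung ◅ back ◅ ε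

    far-around : Star (Arc D) (vt (suc i) q (not (h i))) (vt (suc i) q (h i))
    far-around = back ◅ near-rung ◅ forth ◅ ε

    near-connected : ∀ s t → Star (Arc D) (vt i p s) (vt i p t)
    near-connected = Bool-pairs (λ s t → Star (Arc D) (vt i p s) (vt i p t)) ε near-around (near-rung ◅ ε)

    far-connected : ∀ s t → Star (Arc D) (vt (suc i) q s) (vt (suc i) q t)
    far-connected = Bool-pairs (λ s t → Star (Arc D) (vt (suc i) q s) (vt (suc i) q t)) ε (far-rung ◅ ε) far-around

  -- Each rung lies in a directed 4-cycle, so its ends reach each other, and one can pass from
  -- square to square to column 0 and back out. `1 < n` provides a square at column 0.
  all-cyclic⇒reach : 1 < n → (∀ i → suc i < n → Cyclic i) → ∀ u v → Star (Arc D) u v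
  all-cyclic⇒reach 1<n cyc u v = subst₂ (Star (Arc D))
    (sym (vt-unique u (col<n u) refl refl)) (sym (vt-unique v (col<n v) refl refl))
    (to-origin (col u) (col<n u) (row u) ◅◅ from-origin (col v) (col<n v) (row v))
    where
    origin : Fin (n * 2)
    origin = vt 0 (ℕ.<⇒≤ 1<n) true

    to-origin : ∀ i (p : i < n) s → Star (Arc D) (vt i p s) origin
    to-origin zero    p s = Square.near-connected 1<n (cyc 0 1<n) s true
    to-origin (suc i) q s = far-connected s (not (h i)) ◅◅ back ◅ to-origin i p (not (h i))
      where open Square q (cyc i q)

    from-origin : ∀ i (p : i < n) s → Star (Arc D) origin (vt i p s)
    from-origin zero    p s = Square.near-connected 1<n (cyc 0 1<n) true s
    from-origin (suc i) q s = from-origin i p (h i) ◅◅ forth ◅ far-connected (h i) s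
      where open Square q (cyc i q)

-- Convex sets of a strongly oriented ladder.

module Ladder {n : ℕ} {D : Orientation (P n □ P 2)} {h r : ℕ → Bool}
              (L : Grid.IsLadder n D h r) (reach : ∀ u v → Star (Arc D) u v) where

  open Grid n
  open IsLadder L
  open Geodesics D (grid-arc? D) reach public
  open Squares L public

  step-to : ∀ {u j t} .(q : j < n) → Arc D u (vt j q t) → Step h r (col u) (row u) j t
  step-to {j = j} {t} q a =
    subst (λ (j , t) → Step h r _ _ j t) (cong₂ _,_ (col-vt j q t) (row-vt j q t)) (arc⇒step a)

  step-from : ∀ {v i s} .(p : i < n) → Arc D (vt i p s) v → Step h r i s (col v) (row v)
  step-from {i = i} {s} p a =
    subst (λ (i , s) → Step h r i s _ _) (cong₂ _,_ (col-vt i p s) (row-vt i p s)) (arc⇒step a)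

  step-between : ∀ {i s j t} .(p : i < n) .(q : j < n) → Arc D (vt i p s) (vt j q t) → Step h r i s j t
  step-between {i} {s} p q a =
    subst (λ (i , s) → Step h r i s _ _) (cong₂ _,_ (col-vt i p s) (row-vt i p s)) (step-to q a)

  arc-up : ∀ {m} .(p : m < n) .(q : suc m < n) {u v} → Arc D u v → col u ≤ m → m < col v →
    u ≡ vt m p (h m) × v ≡ vt (suc m) q (h m)
  arc-up p q a u≤ <v with cu , cv , ru , rv ← up-crossing (arc⇒step a) u≤ <v =
    vt-unique _ p cu ru , vt-unique _ q cv rv

  arc-down : ∀ {m} .(p : m < n) .(q : suc m < n) {u v} → Arc D u v → m < col u → col v ≤ m →
    u ≡ vt (suc m) q (not (h m)) × v ≡ vt m p (not (h m))
  arc-down p q a <u v≤ with cu , cv , ru , rv ← down-crossing (arc⇒step a) <u v≤ =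
    vt-unique _ q cu ru , vt-unique _ p cv rv

  -- The part right of the cut has one exit arc and one entry arc, so `pocket-closed` compares the
  -- way from exit to entry inside with the one between the outer ends of these arcs. `pre-closed`
  -- is the mirror image.
  suf-closed : ∀ {m} .(p : m < n) .(q : suc m < n) →
    d (vt (suc m) q (not (h m))) (vt (suc m) q (h m)) ≤ 1 + d (vt m p (not (h m))) (vt m p (h m)) →
    Closed (suf n (suc m))
  suf-closed p q = pocket-closed
    (λ a u∈ v∉ → arc-down p q a (∈suf⁻ u∈) (s≤s⁻¹ (∉suf⁻ v∉)))
    (λ a u∉ v∈ → arc-up p q a (s≤s⁻¹ (∉suf⁻ u∉)) (∈suf⁻ v∈))

  pre-closed : ∀ {m} .(p : m < n) .(q : suc m < n) →
    d (vt m p (h m)) (vt m p (not (h m))) ≤ 1 + d (vt (suc m) q (h m)) (vt (suc m) q (not (h m))) →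
    Closed (pre n (suc m))
  pre-closed p q = pocket-closed
    (λ a u∈ v∉ → arc-up p q a (s≤s⁻¹ (∈pre⁻ u∈)) (∉pre⁻ v∉))
    (λ a u∉ v∈ → arc-down p q a (∉pre⁻ u∉) (s≤s⁻¹ (∈pre⁻ v∈)))

  module _ {m : ℕ} (q : suc m < n) where

    suf-proper : Closed (suf n (suc m)) → ProperConvex D (suf n (suc m))
    suf-proper cl =
      closed⇒convex (vt (suc m) q true , ∈suf⁺ (≤-reflexive (sym (col-vt (suc m) q true)))) cl ,
      λ eq → ℕ.n≮0 (subst (m <_) (col-vt 0 (≤-trans (s≤s z≤n) q) true)
        (∈suf⁻ (subst (vt 0 (≤-trans (s≤s z≤n) q) true ∈_) (sym eq) ∈⊤)))

    pre-proper : Closed (pre n (suc m)) → ProperConvex D (pre n (suc m))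
    pre-proper cl =
      closed⇒convex (vt 0 (≤-trans (s≤s z≤n) q) true ,
        ∈pre⁺ (subst (_< suc m) (sym (col-vt 0 (≤-trans (s≤s z≤n) q) true)) (s≤s z≤n))) cl ,
      λ eq → ℕ.<-irrefl (col-vt (suc m) q true) (∈pre⁻ (subst (vt (suc m) q true ∈_) (sym eq) ∈⊤))

  module _ {S : Subset (n * 2)} (cl : Closed S) {m : ℕ} .(p : m < n) .(q : suc m < n)
           {x y : Fin (n * 2)} where

    closed-crossing-right : x ∈ S → y ∈ S → col x ≤ m → m < col y →
      vt m p (h m) ∈ S × vt (suc m) q (h m) ∈ S
    closed-crossing-right x∈ y∈ x≤ <y =
      let _ , _ , a , a≤ , b≰ , a∈ , b∈ = cross-closed (λ w → col w ℕ.≤? m) cl x∈ y∈ x≤ (ℕ.<⇒≱ <y)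
          a≡ , b≡ = arc-up p q a a≤ (ℕ.≰⇒> b≰)
      in subst (_∈ S) a≡ a∈ , subst (_∈ S) b≡ b∈

    closed-crossing-left : x ∈ S → y ∈ S → m < col x → col y ≤ m →
      vt (suc m) q (not (h m)) ∈ S × vt m p (not (h m)) ∈ S
    closed-crossing-left x∈ y∈ <x y≤ =
      let _ , _ , a , <a , ≮b , a∈ , b∈ = cross-closed (λ w → m ℕ.<? col w) cl x∈ y∈ <x (ℕ.≤⇒≯ y≤)
          a≡ , b≡ = arc-down p q a <a (ℕ.≮⇒≥ ≮b)
      in subst (_∈ S) a≡ a∈ , subst (_∈ S) b≡ b∈

  module Nontrivial {S : Subset (n * 2)} (cl : Closed S) {u v : Fin (n * 2)}
                    (u∈ : u ∈ S) (v∈ : v ∈ S) (u≢v : u ≢ v) where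

    successor : ∀ {x} → x ∈ S → ∃[ y ] (Arc D x y × y ∈ S)
    successor {x} x∈ with x Fin.≟ u
    ... | yes refl = out-neighbour cl x∈ v∈ u≢v
    ... | no x≢u   = out-neighbour cl x∈ u∈ x≢u

    -- Two successive out-neighbours inside `S` do not lead back to `u`, since that would reverse an
    -- arc. This is what excludes the value 2.
    3≤∣S∣ : 3 ≤ ∣ S ∣
    3≤∣S∣ with y , a , y∈ ← successor u∈ with z , b , z∈ ← successor y∈ =
      three-distinct u∈ y∈ z∈
        (λ { refl → arc-asym D a a }) (λ { refl → arc-asym D a b }) (λ { refl → arc-asym D b b })

    -- If the out-neighbour inside `S` is not across the rung, it lies in an adjacent column. The
    -- set must then also contain the unique arc back across that cut, and this arc ends in the
    -- other row of column `i`.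
    saturated : ∀ {i s} .(p : i < n) → vt i p s ∈ S → vt i p (not s) ∈ S
    saturated {i} {s} p x∈ = let y , a , y∈ = successor x∈ in go y∈ (step-from p a) refl refl
      where
      go : ∀ {y j t} → y ∈ S → Step h r i s j t → col y ≡ j → row y ≡ t → vt i p (not s) ∈ S
      go {y} y∈ (rung _ t≡) cy ry = subst (_∈ S) (vt-unique y p cy (trans ry t≡)) y∈
      go {y} y∈ (right refl _) cy _ = proj₂ (closed-crossing-left cl p (subst (_< n) cy (col<n y))
        y∈ x∈ (≤-reflexive (sym cy)) (≤-reflexive (col-vt i p s)))
      go {y} y∈ (left {i = j} refl _) cy _ = subst (λ t → vt i p t ∈ S) (sym (not-involutive _))
        (proj₂ (closed-crossing-right cl (subst (_< n) cy (col<n y)) p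
          y∈ x∈ (≤-reflexive cy) (≤-reflexive (sym (col-vt i p s)))))

    column : ∀ {i s} .(p : i < n) → vt i p s ∈ S → ∀ t → vt i p t ∈ S
    column {s = s} p x∈ t with t Bool.≟ s
    ... | yes refl = x∈
    ... | no t≢s = subst (λ t → vt _ p t ∈ S) (sym (¬-not t≢s)) (saturated p x∈)

    ∈⇒column : ∀ {x i} .(p : i < n) → x ∈ S → col x ≡ i → ∀ t → vt i p t ∈ S
    ∈⇒column {x} p x∈ cx = column p (subst (_∈ S) (vt-unique x p cx refl) x∈)

    full : (∀ i (p : i < n) → ∃[ s ] (vt i p s ∈ S)) → S ≡ ⊤
    full all = ⊆-antisym ⊆⊤ λ {x} _ →
      subst (_∈ S) (sym (vt-unique x (col<n x) refl refl)) (column (col<n x) (proj₂ (all (col x) (col<n x))) (row x))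

    columns : Subset n
    columns = tabulate (λ i → lookup S (combine i zero))

    ∣S∣-even : ∣ S ∣ ≡ 2 * ∣ columns ∣
    ∣S∣-even = count-columns {n} S λ i → agree i _ _ refl refl
      where
      corner : ∀ (i : Fin n) s → vt (toℕ i) (toℕ<n i) s ≡ combine i (bit s)
      corner i s = cong (λ j → combine j (bit s)) (fromℕ<-toℕ i (toℕ<n i))

      swap-rows : ∀ (i : Fin n) s → lookup S (combine i (bit s)) ≡ true → lookup S (combine i (bit (not s))) ≡ true
      swap-rows i s eq = []=⇒lookup (subst (_∈ S) (corner i (not s))
        (saturated (toℕ<n i) (subst (_∈ S) (sym (corner i s)) (lookup⇒[]= _ S eq))))

      agree : ∀ (i : Fin n) x y → lookup S (combine i zero) ≡ x → lookup S (combine i (suc zero)) ≡ y →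
        lookup S (combine i zero) ≡ lookup S (combine i (suc zero))
      agree i true  y     ex ey = trans ex (sym (swap-rows i true ex))
      agree i false true  ex ey = trans (swap-rows i false ey) (sym ey)
      agree i false false ex ey = trans ex (sym ey)

    ∣columns∣<n : S ≢ ⊤ → ∣ columns ∣ < n
    ∣columns∣<n S≢⊤ = ℕ.≤∧≢⇒< (∣p∣≤n columns) λ eq →
      S≢⊤ (∣p∣≡n⇒p≡⊤ (trans ∣S∣-even (trans (cong (2 *_) eq) (ℕ.*-comm 2 n))))

  -- Against the rung, one step is impossible, and so are two: leaving the column and coming
  -- straight back keeps the row.
  rung-distance : ∀ {i s} (p : i < n) → r i ≡ not s → 3 ≤ d (vt i p s) (vt i p (not s))
  rung-distance {i} {s} p ri = 3≤d (vt-≢ p)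
    (λ a → no-arc (step-between p p a))
    (λ a b → no-pair (step-from p a) (step-to p b))
    where
    no-arc : ¬ Step h r i s i (not s)
    no-arc (rung eq _) = not-¬ refl (trans eq ri)

    no-pair : ∀ {j t} → Step h r i s j t → ¬ Step h r j t i (not s)
    no-pair (right _ refl) (left _ eq)  = not-¬ refl (sym eq)
    no-pair (left _ refl)  (right _ eq) = not-¬ refl (sym eq)
    no-pair (rung eq _)    _            = not-¬ refl (trans eq ri)

  module _ {i : ℕ} (q : suc i < n) (c : Cyclic i) where

    open Square q c

    module _ {S : Subset (n * 2)} (cl : Closed S) where

      -- Going against the rung takes at least 3 steps, and the way around the square takes exactly
      -- 3, so it is a geodesic through the other column. `spread-left` uses the far rung in the
      -- same way.
      spread-right : (∀ s → vt i p s ∈ S) → vt (suc i) q (h i) ∈ S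
      spread-right col∈ = cl (col∈ (h i)) (col∈ (not (h i)))
        (≤-trans (+-mono-≤ (d-arc forth) (d≤length (far-rung ◅ back ◅ ε))) (rung-distance p (proj₁ c)))

      spread-left : (∀ s → vt (suc i) q s ∈ S) → vt i p (h i) ∈ S
      spread-left col∈ = cl (col∈ (not (h i))) (col∈ (h i))
        (≤-trans (+-mono-≤ (d≤length (back ◅ near-rung ◅ ε)) (d-arc forth))
          (subst (λ s → 3 ≤ d (vt (suc i) q (not (h i))) (vt (suc i) q s)) (not-involutive (h i))
            (rung-distance q (trans (proj₂ c) (sym (not-involutive (h i)))))))

  -- Two vertices give a full column, which spreads through the squares down to column 0 and from
  -- there up to every column.
  all-cyclic⇒full : (∀ i → suc i < n → Cyclic i) → ∀ {S} → Closed S →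
    ∀ {u v} → u ∈ S → v ∈ S → u ≢ v → S ≡ ⊤
  all-cyclic⇒full cyc {S} cl {u} {v} u∈ v∈ u≢v = full λ i p → true , reach-column i p true
    where
    open Nontrivial cl u∈ v∈ u≢v

    down : ∀ i (p : i < n) → (∀ s → vt i p s ∈ S) → ∀ s → vt 0 (≤-trans (s≤s z≤n) p) s ∈ S
    down zero    p col∈ = col∈
    down (suc i) q col∈ = down i (ℕ.<⇒≤ q) (column (ℕ.<⇒≤ q) (spread-left q (cyc i q) cl col∈))

    up : ∀ i (p : i < n) → (∀ s → vt 0 (≤-trans (s≤s z≤n) p) s ∈ S) → ∀ s → vt i p s ∈ S
    up zero    p col∈ = col∈
    up (suc i) q col∈ = column q (spread-right q (cyc i q) cl (up i (ℕ.<⇒≤ q) col∈))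

    reach-column : ∀ i (p : i < n) → ∀ s → vt i p s ∈ S
    reach-column i p = up i p (down (col u) (col<n u) (∈⇒column (col<n u) u∈ refl))

-- The lower bound: without large proper convex sets all squares are cyclic.

module Spreading {n : ℕ} {D : Orientation (P n □ P 2)} {h r : ℕ → Bool}
                 (L : Grid.IsLadder n D h r) (reach : ∀ u v → Star (Arc D) u v)
                 {k : ℕ} (2K≤n : suc k + suc k ≤ n)
                 (small : ∀ S → ProperConvex D S → ∣ S ∣ < suc k * 2) where

  open Grid n
  open IsLadder L
  open Ladder L reach

  suf-not-closed : ∀ {m} (q : suc m < n) → suc k ≤ n ∸ suc m → ¬ Closed (suf n (suc m))
  suf-not-closed q K≤ cl = ℕ.<⇒≱ (small _ (suf-proper q cl))
    (≤-trans (ℕ.*-monoˡ-≤ 2 K≤) (≤-reflexive (sym (∣suf∣ {n} (ℕ.<⇒≤ q)))))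

  pre-not-closed : ∀ {m} (q : suc m < n) → suc k ≤ suc m → ¬ Closed (pre n (suc m))
  pre-not-closed q K≤ cl = ℕ.<⇒≱ (small _ (pre-proper q cl))
    (≤-trans (ℕ.*-monoˡ-≤ 2 K≤) (≤-reflexive (sym (∣pre∣ {n} (ℕ.<⇒≤ q)))))

  -- Pointing the other way, this rung would lead directly from the exit of the right part to its
  -- entry, making a part of at least `suc k` columns convex.
  suf-rung : ∀ {m} (q : suc m < n) → suc k ≤ n ∸ suc m → r (suc m) ≡ h m
  suf-rung {m} q K≤ with r (suc m) Bool.≟ h m
  ... | yes eq = eq
  ... | no neq = ⊥-elim (suf-not-closed q K≤ (suf-closed (ℕ.<⇒≤ q) q (≤-trans
    (d-arc (arc q q (rung (sym (¬-not neq)) (sym (not-involutive _))))) (s≤s z≤n))))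

  pre-rung : ∀ {m} (q : suc m < n) → suc k ≤ suc m → r m ≡ not (h m)
  pre-rung {m} q K≤ with r m Bool.≟ h m
  ... | no neq = ¬-not neq
  ... | yes eq = ⊥-elim (pre-not-closed q K≤ (pre-closed (ℕ.<⇒≤ q) q (≤-trans
    (d-arc (arc (ℕ.<⇒≤ q) (ℕ.<⇒≤ q) (rung (sym eq) refl))) (s≤s z≤n))))

  -- By `suf-rung` only the rung in column `i` could spoil square `i`. If it did, its ends would be
  -- at least 3 apart in the direction needed outside, while inside the cyclic square `suc i` leads
  -- from exit to entry in 3 steps; the right part would be convex.
  left-step : ∀ {i} (q : suc (suc i) < n) → suc k ≤ n ∸ suc i → Cyclic (suc i) → Cyclic i
  left-step {i} q K≤ c with suf-rung (ℕ.<⇒≤ q) K≤ | r i Bool.≟ h i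
  ... | ri⁺ | no neq = ¬-not neq , ri⁺
  ... | ri⁺ | yes eq = ⊥-elim (suf-not-closed p K≤ (suf-closed p′ p (≤-trans inside≤3 (m≤n⇒m≤1+n outside≥3))))
    where
    p : suc i < n
    p = ℕ.<⇒≤ q

    p′ : i < n
    p′ = ℕ.<⇒≤ p

    -- The rung in column `suc i` is read twice, in the cyclic square to its right and through
    -- `suf-rung`.
    h-flip : not (h (suc i)) ≡ h i
    h-flip = trans (sym (proj₁ c)) ri⁺

    inside≤3 : d (vt (suc i) p (not (h i))) (vt (suc i) p (h i)) ≤ 3
    inside≤3 = subst₂ (λ s t → d (vt (suc i) p s) (vt (suc i) p t) ≤ 3)
      (trans (sym (not-involutive _)) (cong not h-flip)) h-flip (d≤length (Square.near-around q c))

    outside≥3 : 3 ≤ d (vt i p′ (not (h i))) (vt i p′ (h i))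
    outside≥3 = subst (λ t → 3 ≤ d (vt i p′ (not (h i))) (vt i p′ t)) (not-involutive (h i))
      (rung-distance p′ (trans eq (sym (not-involutive (h i)))))

  right-step : ∀ {i} (q : suc (suc i) < n) → suc k ≤ suc (suc i) → Cyclic i → Cyclic (suc i)
  right-step {i} q K≤ c with pre-rung q K≤ | r (suc (suc i)) Bool.≟ h (suc i)
  ... | ri⁺ | yes eq = ri⁺ , eq
  ... | ri⁺ | no neq = ⊥-elim (pre-not-closed q K≤ (pre-closed p q (≤-trans inside≤3 (m≤n⇒m≤1+n outside≥3))))
    where
    p : suc i < n
    p = ℕ.<⇒≤ q

    h-flip : h i ≡ not (h (suc i))
    h-flip = trans (sym (proj₂ c)) ri⁺

    inside≤3 : d (vt (suc i) p (h (suc i))) (vt (suc i) p (not (h (suc i)))) ≤ 3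
    inside≤3 = subst₂ (λ s t → d (vt (suc i) p s) (vt (suc i) p t) ≤ 3)
      (trans (cong not h-flip) (not-involutive _)) h-flip (d≤length (Square.far-around p c))

    outside≥3 : 3 ≤ d (vt (suc (suc i)) q (h (suc i))) (vt (suc (suc i)) q (not (h (suc i))))
    outside≥3 = rung-distance q (¬-not neq)

  middle : suc k < n
  middle = ≤-trans (s≤s (s≤s (ℕ.m≤n+m k k))) (≤-trans (≤-reflexive (cong suc (sym (ℕ.+-suc k k)))) 2K≤n)

  -- Both sides of the cut after column `k` have at least `suc k` columns, so the rungs on both
  -- sides of it are forced.
  cyclic-middle : Cyclic k
  cyclic-middle = pre-rung middle ≤-refl , suf-rung middle (ℕ.m+n≤o⇒m≤o∸n (suc k) 2K≤n)

  cyclic-left : ∀ i → i ≤ k → Cyclic i → ∀ {j} → j ≤ i → Cyclic j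
  cyclic-left i i≤ c {j} j≤ with ℕ.m≤n⇒m<n∨m≡n j≤
  ... | inj₂ refl = c
  cyclic-left (suc i) i≤ c j≤ | inj₁ j< = cyclic-left i (ℕ.<⇒≤ i≤)
    (left-step (≤-trans (s≤s (s≤s i≤)) middle)
      (≤-trans (ℕ.m+n≤o⇒m≤o∸n (suc k) 2K≤n) (ℕ.∸-monoʳ-≤ n (m≤n⇒m≤1+n i≤))) c) (s≤s⁻¹ j<)

  -- Induction on the offset `t` from the middle square; the prefixes only grow.
  cyclic-right : ∀ t → suc (t + k) < n → Cyclic (t + k)
  cyclic-right zero    _ = cyclic-middle
  cyclic-right (suc t) q = right-step q (s≤s (m≤n⇒m≤1+n (ℕ.m≤n+m k t))) (cyclic-right t (ℕ.<⇒≤ q))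

  all-cyclic : ∀ i → suc i < n → Cyclic i
  all-cyclic i q with ℕ.≤-total i k
  ... | inj₁ i≤k = cyclic-left k ≤-refl cyclic-middle i≤k
  ... | inj₂ k≤i = subst Cyclic (ℕ.m∸n+n≡m k≤i)
    (cyclic-right (i ∸ k) (subst (λ j → suc j < n) (sym (ℕ.m∸n+n≡m k≤i)) q))

-- Only the listed values occur.

⌊n/2⌋+⌊n/2⌋≤n : ∀ n → ⌊ n /2⌋ + ⌊ n /2⌋ ≤ n
⌊n/2⌋+⌊n/2⌋≤n n = ≤-trans (+-monoʳ-≤ ⌊ n /2⌋ (ℕ.⌊n/2⌋≤⌈n/2⌉ n)) (≤-reflexive (ℕ.⌊n/2⌋+⌈n/2⌉≡n n))

-- If the largest proper convex set `S` had fewer than `K` columns, all proper convex sets would be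
-- small enough for `Spreading`; all squares would be cyclic and `S` would be everything.
size-nontrivial : ∀ {n} (D : Orientation (P n □ P 2)) → Strong D →
  ∀ {S} → ProperConvex D S → (∀ S′ → ProperConvex D S′ → ∣ S′ ∣ ≤ ∣ S ∣) →
  ∀ {u v} → u ∈ S → v ∈ S → u ≢ v → ∀ {K} → 0 < K → K + K ≤ n →
  3 ≤ ∣ S ∣ × ∃[ j ] (K ≤ j × j < n × ∣ S ∣ ≡ 2 * j)
size-nontrivial {n} D str {S} (conv , S≢⊤) max u∈ v∈ u≢v {suc k} (s≤s z≤n) 2K≤n =
  let _ , _ , L = Grid.strong⇒ladder n D str in analyse L
  where
  reach : ∀ u v → Star (Arc D) u v
  reach u v = proj₁ (str u v)

  analyse : ∀ {h r} → Grid.IsLadder n D h r → 3 ≤ ∣ S ∣ × ∃[ j ] (suc k ≤ j × j < n × ∣ S ∣ ≡ 2 * j)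
  analyse L = 3≤∣S∣ , ∣ columns ∣ , half≤ , ∣columns∣<n S≢⊤ , ∣S∣-even
    where
    open Ladder L reach
    open Nontrivial (convex⇒closed conv) u∈ v∈ u≢v

    half≤ : suc k ≤ ∣ columns ∣
    half≤ = ℕ.≮⇒≥ λ lt → S≢⊤ (all-cyclic⇒full
      (Spreading.all-cyclic L reach 2K≤n λ S′ pc′ →
        ℕ.≤-<-trans (max S′ pc′) (subst₂ _<_ (sym ∣S∣-even) (ℕ.*-comm 2 (suc k)) (ℕ.*-monoʳ-< 2 lt)))
      (convex⇒closed conv) u∈ v∈ u≢v)

spectrum⊆ : ∀ {n} → 2 ≤ n → ∀ {k} → S-SC (P n □ P 2) k →
  (1 ≡ k ⊎ ∃[ j ] (⌊ n /2⌋ ≤ j × j ≤ n ∸ 1 × k ≡ 2 * j)) × ¬ (2 ≡ k)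
spectrum⊆ {n} 2≤n (D , str , (S , pc , refl) , max) = case ∣ S ∣ ℕ.≟ 1 of λ where
  (yes eq) → inj₁ (sym eq) , λ eq′ → case trans eq′ eq of λ ()
  (no ≢1) →
    let _ , _ , u∈ , v∈ , u≢v = nonsingleton (proj₁ (proj₁ pc)) ≢1
        3≤ , j , half≤ , j< , eq = size-nontrivial D str pc max u∈ v∈ u≢v (ℕ.⌊n/2⌋-mono 2≤n) (⌊n/2⌋+⌊n/2⌋≤n n)
    in inj₂ (j , half≤ , ℕ.<⇒≤pred j< , eq) , ℕ.<⇒≢ 3≤

-- Realising the value 1.

module Alternating {n : ℕ} (1<n : 1 < n) where

  -- Adjacent cyclic squares share a rung, which forces their `h` values to be opposite.
  even : ℕ → Bool
  even zero    = true
  even (suc i) = not (even i)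

  D : Orientation (P n □ P 2)
  D = Grid.ladder n even (not ∘ even)

  L : Grid.IsLadder n D even (not ∘ even)
  L = record { arc⇒step = λ a → a ; step⇒arc = λ a → a }

  cyclic : ∀ i → suc i < n → Squares.Cyclic L i
  cyclic i _ = refl , not-involutive (even i)

  open Ladder L (Squares.all-cyclic⇒reach L 1<n cyclic)

  convexity-number : IsConvexityNumber D 1
  convexity-number = (⁅ o ⁆ , (closed⇒convex (o , x∈⁅x⁆ o) (singleton-closed o) , proper) , ∣⁅x⁆∣≡1 o) , maximal
    where
    o : Fin (n * 2)
    o = Grid.vt n 0 (ℕ.<⇒≤ 1<n) true

    proper : ⁅ o ⁆ ≢ ⊤
    proper eq = vt-≢ _ (sym (x∈⁅y⁆⇒x≡y o (subst (Grid.vt n 0 (ℕ.<⇒≤ 1<n) false ∈_) (sym eq) ∈⊤)))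
      where open Grid n

    maximal : ∀ S → ProperConvex D S → ∣ S ∣ ≤ 1
    maximal S (conv , S≢⊤) with ∣ S ∣ ℕ.≟ 1
    ... | yes eq = ≤-reflexive eq
    ... | no ≢1 with u , v , u∈ , v∈ , u≢v ← nonsingleton (proj₁ conv) ≢1 =
      contradiction (all-cyclic⇒full cyclic (convex⇒closed conv) u∈ v∈ u≢v) S≢⊤

  spectrum : S-SC (P n □ P 2) 1
  spectrum = D , strong , convexity-number

-- Realising the values `2 * j` with `2 ≤ j`.

module Walks {n : ℕ} {D : Orientation (P n □ P 2)} {h r : ℕ → Bool} (L : Grid.IsLadder n D h r) where

  open Grid n
  open IsLadder L

  Reach : ℕ → Fin (n * 2) → Fin (n * 2) → Set
  Reach ℓ u v = Σ[ w ∈ Star (Arc D) u v ] length w ≡ ℓ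

  infixr 5 _⊕_
  _⊕_ : ∀ {ℓ ℓ′ u v w} → Reach ℓ u v → Reach ℓ′ v w → Reach (ℓ + ℓ′) u w
  (p , eq) ⊕ (q , eq′) = p ◅◅ q , trans (length-◅◅ p q) (cong₂ _+_ eq eq′)

  ascend : ∀ k {i m s} .(p : i < n) .(q : m < n) → k + i ≡ m → (∀ {l} → i ≤ l → l < m → s ≡ h l) →
    Reach k (vt i p s) (vt m q s)
  ascend zero    p q refl _ = ε , refl
  ascend (suc k) {i} p q refl dir =
    let w , eq = ascend k {suc i} (≤-trans (s≤s i<m) q) q (ℕ.+-suc k i) (λ i<l → dir (ℕ.<⇒≤ i<l))
    in arc p (≤-trans (s≤s i<m) q) (right (dir ≤-refl i<m) refl) ◅ w , cong suc eq
    where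
    i<m : i < suc (k + i)
    i<m = s≤s (ℕ.m≤n+m i k)

  descend : ∀ k {i m s} .(p : i < n) .(q : m < n) → k + i ≡ m → (∀ {l} → i ≤ l → l < m → s ≡ not (h l)) →
    Reach k (vt m q s) (vt i p s)
  descend zero    p q refl _ = ε , refl
  descend (suc k) {i} p q refl dir =
    let w , eq = descend k p (ℕ.<⇒≤ q) refl (λ i≤l l< → dir i≤l (m≤n⇒m≤1+n l<))
    in arc q (ℕ.<⇒≤ q) (left (dir (ℕ.m≤n+m i k) ≤-refl) refl) ◅ w , cong suc eq

-- Row true flows towards column c, row false away from it; every rung leads from row true to
-- row false, except the last one and, when c > 0, the first one. The part right of column c is
-- convex, and a convex set meeting both sides of column c is everything, since the way back
-- from (c , false) to (c , true) over the left end is a geodesic.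
module Mountain {n c j : ℕ} (n≡ : n ≡ suc (c + j)) (c≤j : c ≤ j) (2≤j : 2 ≤ j) where

  open Grid n

  M : ℕ
  M = c + j

  -- The disjunct `c ≤ᵇ i` matters for `c = 0` only: there is then no left cycle to close, and the
  -- rung in column 0 counts as an inner one.
  h r : ℕ → Bool
  h i = i <ᵇ c
  r i = (i <ᵇ M) ∧ ((c ≤ᵇ i) ∨ (0 <ᵇ i))

  <ᵇ-true : ∀ {i m} → i < m → (i <ᵇ m) ≡ true
  <ᵇ-true lt = Equivalence.to Bool.T-≡ (ℕ.<⇒<ᵇ lt)

  <ᵇ-false : ∀ {i m} → m ≤ i → (i <ᵇ m) ≡ false
  <ᵇ-false {i} {m} le = ¬-not λ eq → ℕ.<⇒≱ (ℕ.<ᵇ⇒< i m (Equivalence.from Bool.T-≡ eq)) le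

  r-last : r M ≡ false
  r-last = cong (_∧ ((c ≤ᵇ M) ∨ (0 <ᵇ M))) (<ᵇ-false {M} ≤-refl)

  r-first : 0 < c → r 0 ≡ false
  r-first (s≤s z≤n) = Bool.∧-zeroʳ (0 <ᵇ M)

  r-inner : ∀ {i} → i < M → c ≤ i ⊎ 0 < i → r i ≡ true
  r-inner {i} lt (inj₁ le) = cong₂ (λ x y → x ∧ (y ∨ (0 <ᵇ i))) (<ᵇ-true lt) (Equivalence.to Bool.T-≡ (ℕ.≤⇒≤ᵇ le))
  r-inner {i} lt (inj₂ pos) = trans (cong₂ (λ x y → x ∧ ((c ≤ᵇ i) ∨ y)) (<ᵇ-true lt) (<ᵇ-true pos)) (Bool.∨-zeroʳ _)

  r-false : ∀ {i} → i ≤ M → false ≡ r i → i ≡ 0 ⊎ i ≡ M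
  r-false {zero}  _  _  = inj₁ refl
  r-false {suc i} i≤ eq with ℕ.m≤n⇒m<n∨m≡n i≤
  ... | inj₂ i≡ = inj₂ i≡
  ... | inj₁ i< = case trans eq (r-inner i< (inj₂ (s≤s z≤n))) of λ ()

  fits : ∀ {i} → i ≤ M → i < n
  fits le = subst (_ <_) (sym n≡) (s≤s le)

  bound : ∀ {i} → i < n → i ≤ M
  bound lt = s≤s⁻¹ (subst (_ <_) n≡ lt)

  c≤M : c ≤ M
  c≤M = ℕ.m≤m+n c j

  c<M : c < M
  c<M = ≤-trans (≤-reflexive (sym (ℕ.+-comm c 1))) (+-monoʳ-≤ c (≤-trans (s≤s z≤n) 2≤j))

  D : Orientation (P n □ P 2)
  D = ladder h r

  L : IsLadder D h r
  L = record { arc⇒step = λ a → a ; step⇒arc = λ a → a }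

  open IsLadder L using (arc)
  open Walks L

  top bottom : ∀ i → .(i < n) → Fin (n * 2)
  top i p    = vt i p true
  bottom i p = vt i p false

  module _ {i : ℕ} where

    top-rise : .(p : i < n) → i ≤ c → Reach (c ∸ i) (top i p) (top c (fits c≤M))
    top-rise p i≤ = ascend (c ∸ i) p _ (ℕ.m∸n+n≡m i≤) (λ _ l< → sym (<ᵇ-true l<))

    top-fall : ∀ k {m} .(p : i < n) .(q : m < n) → k + i ≡ m → c ≤ i → Reach k (top m q) (top i p)
    top-fall k p q eq c≤ = descend k p q eq (λ i≤ _ → cong not (sym (<ᵇ-false (≤-trans c≤ i≤))))

    bottom-rise : ∀ k {m} .(p : i < n) .(q : m < n) → k + i ≡ m → c ≤ i → Reach k (bottom i p) (bottom m q)
    bottom-rise k p q eq c≤ = ascend k p q eq (λ i≤ _ → sym (<ᵇ-false (≤-trans c≤ i≤)))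

    bottom-fall : ∀ k {m} .(p : i < n) .(q : m < n) → k + i ≡ m → m ≤ c → Reach k (bottom m q) (bottom i p)
    bottom-fall k p q eq m≤ = descend k p q eq (λ _ l< → cong not (sym (<ᵇ-true (≤-trans l< m≤))))

  last-rung : Reach 1 (bottom M (fits ≤-refl)) (top M (fits ≤-refl))
  last-rung = arc _ _ (rung (sym r-last) refl) ◅ ε , refl

  first-rung : 0 < c → Reach 1 (bottom 0 (fits z≤n)) (top 0 (fits z≤n))
  first-rung 0<c = arc _ _ (rung (sym (r-first 0<c)) refl) ◅ ε , refl

  -- The two routes from row `false` back to `(c , true)`, over the right end here and over the left
  -- end in `return-left`. Their exact lengths are later compared with the distance.
  return-right : ∀ k {i} .(p : i < n) → k + i ≡ M → c ≤ i → Reach (k + (1 + j)) (bottom i p) (top c (fits c≤M))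
  return-right k p eq c≤ = bottom-rise k p _ eq c≤ ⊕ last-rung ⊕ top-fall j _ _ (ℕ.+-comm j c) ≤-refl

  return-left : ∀ {i} .(p : i < n) → 0 < c → i ≤ c → Reach (i + (1 + c)) (bottom i p) (top c (fits c≤M))
  return-left {i} p 0<c i≤ = bottom-fall i _ p (ℕ.+-identityʳ i) i≤ ⊕ first-rung 0<c ⊕ top-rise _ z≤n

  to-hub : ∀ i (p : i < n) s → Star (Arc D) (vt i p s) (top c (fits c≤M))
  to-hub i p true with ℕ.≤-total i c
  ... | inj₁ i≤c = proj₁ (top-rise p i≤c)
  ... | inj₂ c≤i = proj₁ (top-fall (i ∸ c) _ p (ℕ.m∸n+n≡m c≤i) ≤-refl)
  to-hub i p false with c ℕ.≤? i
  ... | yes c≤i = proj₁ (return-right (M ∸ i) p (ℕ.m∸n+n≡m (bound p)) c≤i)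
  ... | no c≰i = proj₁ (return-left p (ℕ.m<n⇒0<n (ℕ.≰⇒> c≰i)) (ℕ.<⇒≤ (ℕ.≰⇒> c≰i)))

  drop-down : Reach 1 (top c (fits c≤M)) (bottom c (fits c≤M))
  drop-down = arc _ _ (rung (sym (r-inner c<M (inj₁ ≤-refl))) refl) ◅ ε , refl

  from-hub : ∀ i (p : i < n) s → Star (Arc D) (top c (fits c≤M)) (vt i p s)
  from-hub i p s with c ℕ.≤? i
  from-hub i p false | yes c≤i = proj₁ (drop-down ⊕ bottom-rise (i ∸ c) _ p (ℕ.m∸n+n≡m c≤i) ≤-refl)
  from-hub i p true  | yes c≤i = proj₁ (drop-down ⊕ bottom-rise j _ _ (ℕ.+-comm j c) ≤-refl ⊕ last-rung
                                 ⊕ top-fall (M ∸ i) p _ (ℕ.m∸n+n≡m (bound p)) c≤i)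
  from-hub i p false | no c≰i = proj₁ (drop-down ⊕ bottom-fall (c ∸ i) p _ (ℕ.m∸n+n≡m (ℕ.<⇒≤ (ℕ.≰⇒> c≰i))) ≤-refl)
  from-hub i p true  | no c≰i = proj₁ (drop-down ⊕ bottom-fall c _ _ (ℕ.+-identityʳ c) ≤-refl
                                 ⊕ first-rung (ℕ.m<n⇒0<n i<c)
                                 ⊕ ascend i _ p (ℕ.+-identityʳ i) (λ _ l< → sym (<ᵇ-true (ℕ.<-trans l< i<c))))
    where i<c = ℕ.≰⇒> c≰i

  reach : ∀ u v → Star (Arc D) u v
  reach u v = subst₂ (Star (Arc D))
    (sym (vt-unique u (col<n u) refl refl)) (sym (vt-unique v (col<n v) refl refl))
    (to-hub (col u) (col<n u) (row u) ◅◅ from-hub (col v) (col<n v) (row v))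

  open Ladder L reach

  -- A lower bound for the distance to (c , true): from row false one first has to get to
  -- column 0 or to column M.
  potential : ℕ → Bool → ℕ
  potential i true  = gap i c
  potential i false = suc ((i + c) ⊓ (gap i M + j))

  gap-suc : ∀ i → gap i (suc i) ≡ 1
  gap-suc zero    = refl
  gap-suc (suc i) = gap-suc i

  gap-forth : ∀ i m → gap i m ≤ suc (gap (suc i) m)
  gap-forth i m = subst (λ x → gap i m ≤ x + gap (suc i) m) (gap-suc i) (ℕ.∣-∣-triangle i (suc i) m)

  gap-back : ∀ i m → gap (suc i) m ≤ suc (gap i m)
  gap-back i m = subst (λ x → gap (suc i) m ≤ x + gap i m) (trans (ℕ.∣-∣-comm (suc i) i) (gap-suc i))
    (ℕ.∣-∣-triangle (suc i) i m)

  gap-M-c : gap M c ≡ j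
  gap-M-c = trans (ℕ.∣-∣-comm M c) (ℕ.∣m-m+n∣≡n c j)

  potential-step : ∀ {i s k t} → i ≤ M → Step h r i s k t → potential i s ≤ suc (potential k t)
  potential-step {i} {true}  _ (right _ refl) = gap-forth i c
  potential-step {i} {false} _ (right _ refl) = s≤s (ℕ.⊓-mono-≤ (ℕ.m≤n+m (i + c) 2) (+-monoˡ-≤ j (gap-forth i M)))
  potential-step {s = true}  {k} _ (left _ refl) = gap-back k c
  potential-step {s = false} {k} _ (left _ refl) = s≤s (ℕ.⊓-mono-≤ ≤-refl (+-monoˡ-≤ j (gap-back k M)))
  -- Both terms of the minimum bound the gap to `c`: the first directly, the second by the triangle
  -- inequality through `M`.
  potential-step {i} {true}  _ (rung _ refl) = ≤-trans (ℕ.⊓-glb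
    (≤-trans (ℕ.∣m-n∣≤m⊔n i c) (ℕ.m⊔n≤m+n i c))
    (subst (λ x → gap i c ≤ gap i M + x) gap-M-c (ℕ.∣-∣-triangle i M c))) (ℕ.m≤n+m _ 2)
  -- A rung can leave row `false` in columns 0 and `M` only, where one term of the minimum equals
  -- the gap to `c`.
  potential-step {i} {false} i≤ (rung eq refl) with r-false i≤ eq
  ... | inj₁ refl = s≤s (ℕ.m⊓n≤m c _)
  ... | inj₂ refl = s≤s (≤-trans (ℕ.m⊓n≤n (M + c) _)
    (≤-reflexive (trans (cong (_+ j) (ℕ.∣n-n∣≡0 M)) (sym gap-M-c))))

  -- The potential at `(c , false)` is one more than the minimum of `c + c` and `j + j`, and
  -- `c ≤ j`.
  around≤d : suc (c + c) ≤ d (bottom c (fits c≤M)) (top c (fits c≤M))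
  around≤d = begin
    suc (c + c)                                     ≤⟨ s≤s (ℕ.⊓-glb ≤-refl (+-mono-≤ c≤gap c≤j)) ⟩
    potential c false                               ≡⟨ cong₂ potential (sym (col-vt c _ false)) (sym (row-vt c _ false)) ⟩
    potential (col b) (row b)                       ≤⟨ d-potential (λ v → potential (col v) (row v))
                                                         (λ {x} → potential-step (bound (col<n x))) b a ⟩
    d b a + potential (col a) (row a)               ≡⟨ cong (d b a +_) (cong₂ potential (col-vt c _ true) (row-vt c _ true)) ⟩
    d b a + gap c c                                 ≡⟨ cong (d b a +_) (ℕ.∣n-n∣≡0 c) ⟩
    d b a + 0                                       ≡⟨ ℕ.+-identityʳ _ ⟩
    d b a                                           ∎
    where
    open ≤-Reasoning
    a = top c (fits c≤M)
    b = bottom c (fits c≤M)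
    c≤gap : c ≤ gap c M
    c≤gap = ≤-trans c≤j (≤-reflexive (sym (ℕ.∣m-m+n∣≡n c j)))

  module _ {S : Subset (n * 2)} (cl : Closed S)
           (bottom∈ : bottom c (fits c≤M) ∈ S) (top∈ : top c (fits c≤M) ∈ S) where

    -- The route over the left end has length `suc (c + c)`, hence is a geodesic by `around≤d`; its
    -- first step goes to column `i`.
    hub-spreads-left : ∀ {i} .(p : i < n) → suc i ≡ c → bottom i p ∈ S
    hub-spreads-left {i} p refl = cl bottom∈ top∈ (≤-trans (+-mono-≤
      (d-arc (arc _ p (left (cong not (sym (<ᵇ-true {i} ≤-refl))) refl)))
      (let w , eq = return-left p (s≤s z≤n) (n≤1+n i) in ≤-trans (d≤length w) (≤-reflexive eq)))
      (≤-trans (≤-reflexive (cong suc (ℕ.+-suc i (suc i)))) around≤d))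

    -- For `c ≡ j` the route over the right end is equally short. In the proof `j = 2 + k`, so that
    -- `suc k` steps lead from column `suc c` to `M`.
    hub-spreads-right : ∀ .(q : suc c < n) → c ≡ j → bottom (suc c) q ∈ S
    hub-spreads-right q c≡j with k , refl ← ℕ.m≤n⇒∃[o]m+o≡n 2≤j = cl bottom∈ top∈ (≤-trans (+-mono-≤
      (d-arc (arc _ q (right (sym (<ᵇ-false {c} ≤-refl)) refl)))
      (let w , eq = return-right (suc k) q (trans (ℕ.+-comm (suc k) (suc c)) (sym (ℕ.+-suc c (suc k)))) (n≤1+n c)
       in ≤-trans (d≤length w) (≤-reflexive eq)))
      (≤-trans (≤-reflexive (cong₂ (λ x y → x + suc y) (sym c≡j) (sym c≡j))) (≤-trans (≤-reflexive (ℕ.+-suc c c)) around≤d)))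

  module Maximality {S : Subset (n * 2)} (cl : Closed S) (S≢⊤ : S ≢ ⊤) {u v : Fin (n * 2)}
                    (u∈ : u ∈ S) (v∈ : v ∈ S) (u≢v : u ≢ v) where

    open Nontrivial cl u∈ v∈ u≢v

    -- Strictly between columns `c` and `M` the only arc out of row `false` goes right, so the
    -- out-neighbour inside `S` is known. `go-left` is the counterpart left of `c`.
    go-right : ∀ {i} .(p : i < n) .(q : suc i < n) → c < i → i < M → bottom i p ∈ S → bottom (suc i) q ∈ S
    go-right {i} p q c< i<M b∈ = let y , a , y∈ = successor b∈ in follow y∈ (step-from p a) refl refl
      where
      follow : ∀ {y k t} → y ∈ S → Step h r i false k t → col y ≡ k → row y ≡ t → bottom (suc i) q ∈ S
      follow {y} y∈ (right _ refl) cy ry = subst (_∈ S) (vt-unique y q cy ry) y∈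
      follow     _  (left eq _) _ _ = case trans eq (cong not (<ᵇ-false (s≤s⁻¹ c<))) of λ ()
      follow     _  (rung eq _) _ _ = case trans eq (r-inner i<M (inj₁ (ℕ.<⇒≤ c<))) of λ ()

    go-left : ∀ {i} .(p : i < n) .(q : suc i < n) → suc i < c → bottom (suc i) q ∈ S → bottom i p ∈ S
    go-left {i} p q i<c b∈ = let y , a , y∈ = successor b∈ in follow y∈ (step-from q a) refl refl
      where
      follow : ∀ {y k t} → y ∈ S → Step h r (suc i) false k t → col y ≡ k → row y ≡ t → bottom i p ∈ S
      follow {y} y∈ (left _ refl) cy ry = subst (_∈ S) (vt-unique y p cy ry) y∈
      follow     _  (right eq _) _ _ = case trans eq (<ᵇ-true i<c) of λ ()
      follow     _  (rung eq _) _ _ = case trans eq (r-inner (ℕ.<-≤-trans i<c c≤M) (inj₂ (s≤s z≤n))) of λ ()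

    all-right : ∀ {i} (p : i < n) → c < i → bottom (suc c) (fits c<M) ∈ S → bottom i p ∈ S
    all-right {suc i} p c<i b∈ with ℕ.m≤n⇒m<n∨m≡n (s≤s⁻¹ c<i)
    ... | inj₂ refl = b∈
    ... | inj₁ c<i′ = go-right (ℕ.<⇒≤ p) p c<i′ (bound p) (all-right (ℕ.<⇒≤ p) c<i′ b∈)

    all-left : ∀ k {i} (p : i < n) → suc (k + i) ≡ c →
      bottom c (fits c≤M) ∈ S → top c (fits c≤M) ∈ S → bottom i p ∈ S
    all-left zero    p eq b∈ t∈ = hub-spreads-left cl b∈ t∈ p eq
    all-left (suc k) {i} p eq b∈ t∈ = go-left p suc-i<n
      (≤-trans (s≤s (s≤s (ℕ.m≤n+m i k))) (≤-reflexive eq))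
      (all-left k suc-i<n (trans (cong suc (ℕ.+-suc k i)) eq) b∈ t∈)
      where
      suc-i<n : suc i < n
      suc-i<n = fits (≤-trans (≤-trans (s≤s (ℕ.m≤n+m i (suc k))) (≤-reflexive eq)) c≤M)

    -- A set on both sides contains columns `c` and `suc c`. Column `c` spreads to its left
    -- neighbour along a geodesic, and forced out-neighbours carry row `false` on to both ends.
    one-sided : ∀ {x y} → x ∈ S → y ∈ S → ¬ (col x ≤ c × c < col y)
    one-sided x∈ y∈ (x≤ , <y) =
      let hub∈ , next∈ = closed-crossing-right cl (fits c≤M) (fits c<M) x∈ y∈ x≤ <y
          hub = column (fits c≤M) hub∈
          next = column (fits c<M) next∈ false
          decide : ∀ i (p : i < n) → ∃[ s ] (vt i p s ∈ S)
          decide i p = false , (case ℕ.<-cmp i c of λ where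
            (tri< i<c _ _) → all-left (c ∸ suc i) p
              (trans (sym (ℕ.+-suc (c ∸ suc i) i)) (ℕ.m∸n+n≡m i<c)) (hub false) (hub true)
            (tri≈ _ refl _) → hub false
            (tri> _ _ c<i) → all-right p c<i next)
      in S≢⊤ (full decide)

    bounded : ∣ S ∣ ≤ 2 * j
    bounded with any? (λ x → x ∈? S ×-dec col x ℕ.≤? c) | any? (λ y → y ∈? S ×-dec c ℕ.<? col y)
    ... | yes (x , x∈ , x≤) | yes (y , y∈ , <y) = ⊥-elim (one-sided x∈ y∈ (x≤ , <y))
    ... | no none≤ | _ = begin
      ∣ S ∣               ≤⟨ p⊆q⇒∣p∣≤∣q∣ (λ {x} x∈ → ∈suf⁺ (ℕ.≰⇒> λ x≤ → none≤ (x , x∈ , x≤))) ⟩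
      ∣ suf n (suc c) ∣   ≡⟨ ∣suf∣ {n} (fits c≤M) ⟩
      (n ∸ suc c) * 2     ≡⟨ cong (λ m → (m ∸ suc c) * 2) n≡ ⟩
      (M ∸ c) * 2         ≡⟨ cong (_* 2) (ℕ.m+n∸m≡n c j) ⟩
      j * 2               ≡⟨ ℕ.*-comm j 2 ⟩
      2 * j               ∎
      where open ≤-Reasoning
    -- Columns 0 to `c` are `suc c` in number, one too many when `c ≡ j`. In that case column `c` is
    -- avoided as well, since it would spread to column `suc c`.
    ... | yes _ | no none> with ℕ.m≤n⇒m<n∨m≡n c≤j
    ...   | inj₁ c<j = begin
      ∣ S ∣               ≤⟨ p⊆q⇒∣p∣≤∣q∣ (λ {x} x∈ → ∈pre⁺ (s≤s (ℕ.≮⇒≥ λ <x → none> (x , x∈ , <x)))) ⟩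
      ∣ pre n (suc c) ∣   ≡⟨ ∣pre∣ {n} (fits c≤M) ⟩
      suc c * 2           ≤⟨ ℕ.*-monoˡ-≤ 2 c<j ⟩
      j * 2               ≡⟨ ℕ.*-comm j 2 ⟩
      2 * j               ∎
      where open ≤-Reasoning
    ...   | inj₂ c≡j = begin
      ∣ S ∣               ≤⟨ p⊆q⇒∣p∣≤∣q∣ (λ {x} x∈ → ∈pre⁺ (left-of-hub x x∈)) ⟩
      ∣ pre n c ∣         ≡⟨ ∣pre∣ {n} (ℕ.<⇒≤ (fits c≤M)) ⟩
      c * 2               ≡⟨ cong (_* 2) c≡j ⟩
      j * 2               ≡⟨ ℕ.*-comm j 2 ⟩
      2 * j               ∎
      where
      open ≤-Reasoning
      left-of-hub : ∀ x → x ∈ S → col x < c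
      left-of-hub x x∈ with ℕ.<-cmp (col x) c
      ... | tri< x<c _ _ = x<c
      ... | tri> _ _ c<x = ⊥-elim (none> (x , x∈ , c<x))
      ... | tri≈ _ x≡c _ = ⊥-elim (none> (bottom (suc c) (fits c<M) ,
        hub-spreads-right cl (hub false) (hub true) (fits c<M) c≡j ,
        ≤-reflexive (sym (col-vt (suc c) _ false))))
        where
        hub : ∀ t → vt c (fits c≤M) t ∈ S
        hub = ∈⇒column (fits c≤M) x∈ x≡c

  -- The rung in column `suc c` leads straight from the exit of this part to its entry; `2 ≤ j`
  -- ensures that it is not the last rung, which points the other way.
  right-part : ProperConvex D (suf n (suc c))
  right-part = suf-proper (fits c<M) (suf-closed (fits c≤M) (fits c<M)
    (≤-trans (d-arc (arc _ _ (rung closing (sym (not-involutive _))))) (s≤s z≤n)))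
    where
    closing : not (h c) ≡ r (suc c)
    closing = trans (cong not (<ᵇ-false {c} {c} ≤-refl)) (sym (r-inner 1+c<M (inj₂ (s≤s z≤n))))
      where
      1+c<M : suc c < M
      1+c<M = ≤-trans (≤-reflexive (sym (ℕ.+-comm c 2))) (+-monoʳ-≤ c 2≤j)

  spectrum : S-SC (P n □ P 2) (2 * j)
  spectrum = D , strong , (suf n (suc c) , right-part , size) , maximal
    where
    size : ∣ suf n (suc c) ∣ ≡ 2 * j
    size = trans (∣suf∣ {n} (fits c≤M)) (trans (cong (λ m → (m ∸ suc c) * 2) n≡)
      (trans (cong (_* 2) (ℕ.m+n∸m≡n c j)) (ℕ.*-comm j 2)))

    maximal : ∀ S → ProperConvex D S → ∣ S ∣ ≤ 2 * j
    maximal S (conv , S≢⊤) = case ∣ S ∣ ℕ.≟ 1 of λ where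
      (yes eq) → ≤-trans (≤-reflexive eq) (≤-trans (≤-trans (s≤s z≤n) 2≤j) (ℕ.m≤m+n j _))
      (no ≢1) → let _ , _ , u∈ , v∈ , u≢v = nonsingleton (proj₁ conv) ≢1
                in Maximality.bounded (convex⇒closed conv) S≢⊤ u∈ v∈ u≢v

-- All listed values occur.

spectrum⊇ : ∀ {n} → 2 ≤ n → ∀ {k} →
  (1 ≡ k ⊎ ∃[ j ] (⌊ n /2⌋ ≤ j × j ≤ n ∸ 1 × k ≡ 2 * j)) × ¬ (2 ≡ k) → S-SC (P n □ P 2) k
spectrum⊇ 2≤n (inj₁ refl , _) = Alternating.spectrum 2≤n
spectrum⊇ 2≤n (inj₂ (zero , half≤ , _) , _) = contradiction (≤-trans (ℕ.⌊n/2⌋-mono 2≤n) half≤) 1+n≰n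
spectrum⊇ 2≤n (inj₂ (suc zero , _ , _ , refl) , ≢2) = contradiction refl ≢2
spectrum⊇ {n} 2≤n (inj₂ (j@(suc (suc _)) , half≤ , j≤ , refl) , _) =
  -- This `c` leaves `j` columns to its right; `c ≤ j` amounts to `n ≤ suc (j + j)`, which follows
  -- from `⌊ n /2⌋ ≤ j`.
  Mountain.spectrum {c = n ∸ 1 ∸ j} n≡ (ℕ.m≤n+o⇒m∸n≤o (n ∸ 1) j (ℕ.m≤n+o⇒m∸n≤o n 1 n≤)) (s≤s (s≤s z≤n))
  where
  open ≤-Reasoning

  n≡ : n ≡ suc (n ∸ 1 ∸ j + j)
  n≡ = trans (sym (ℕ.m+[n∸m]≡n (ℕ.<⇒≤ 2≤n))) (cong suc (sym (ℕ.m∸n+n≡m j≤)))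

  n≤ : n ≤ suc (j + j)
  n≤ = begin
    n                        ≡⟨ ℕ.⌊n/2⌋+⌈n/2⌉≡n n ⟨
    ⌊ n /2⌋ + ⌈ n /2⌉        ≤⟨ +-monoʳ-≤ ⌊ n /2⌋ (ℕ.⌊n/2⌋-mono (n≤1+n (suc n))) ⟩
    ⌊ n /2⌋ + suc ⌊ n /2⌋    ≤⟨ +-mono-≤ half≤ (s≤s half≤) ⟩
    j + suc j                ≡⟨ ℕ.+-suc j j ⟩
    suc (j + j)              ∎

theorem10 : (n : ℕ) → 2 ≤ n →
    S-SC (P n □ P 2) ≐
    ((｛ 1 ｝ ∪ (λ k → ∃[ j ] (⌊ n /2⌋ ≤ j × j ≤ n ∸ 1 × k ≡ 2 * j))) ∖ ｛ 2 ｝)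
theorem10 n 2≤n = spectrum⊆ 2≤n , spectrum⊇ 2≤n
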